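{- Let $k$ be a prime and $1\le i\le k-1$. Then for every non-negative integer $n$, the polynomial $E_{nk+i|k}(q)$ is divisible in $\mathbb{Z}[q]$ by $[k]_q\,[k]_{q^2}\,[k]_{q^3}\cdots[k]_{q^n}$, where $[k]_{q^a}=1+q^a+q^{2a}+\cdots+q^{(k-1)a}$.
   Context: For a permutation $\pi=a_1\ldots a_N$ of $\{1,\ldots,N\}$, $\mathrm{Des}(\pi)=\{j:1\le j<N,\ a_j>a_{j+1}\}$ and $\mathrm{inv}(\pi)$ is the number of pairs $j<l$ with $a_j>a_l$. The generalized $q$-Euler number is $E_{N|k}(q)=\sum_{\pi}q^{\mathrm{inv}(\pi)}$, summed over permutations $\pi$ of $\{1,\ldots,N\}$ with $\mathrm{Des}(\pi)=\{k,2k,3k,\ldots\}\cap\{1,\ldots,N-1\}$. -}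

module Defs where

open import Data.Nat as ℕ using (ℕ; zero; suc; _<ᵇ_; _≡ᵇ_)
open import Data.Nat.Divisibility using (_∣?_)
open import Data.Integer as ℤ using (ℤ; +_)
open import Data.List using (List; []; _∷_; map; concatMap; filter; foldr; length; replicate; _++_; upTo)
open import Data.Bool using (Bool; true; false; _∧_; not; if_then_else_)
open import Data.Product using (Σ)
open import Relation.Nullary.Decidable using (⌊_⌋)
open import Relation.Binary.PropositionalEquality using (_≡_)

-- Polynomials in ℤ[q] as coefficient lists (constant term first).

Poly : Set
Poly = List ℤ

coeff : Poly → ℕ → ℤ
coeff []       _       = + 0
coeff (c ∷ _)  zero    = c
coeff (_ ∷ cs) (suc m) = coeff cs m

infixl 6 _+ₚ_
infixl 7 _*ₚ_ _·ₚ_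

_+ₚ_ : Poly → Poly → Poly
[]       +ₚ qs       = qs
(p ∷ ps) +ₚ []       = p ∷ ps
(p ∷ ps) +ₚ (q ∷ qs) = (p ℤ.+ q) ∷ (ps +ₚ qs)

_·ₚ_ : ℤ → Poly → Poly
c ·ₚ ps = map (c ℤ.*_) ps

_*ₚ_ : Poly → Poly → Poly
[]       *ₚ qs = []
(p ∷ ps) *ₚ qs = (p ·ₚ qs) +ₚ (+ 0 ∷ (ps *ₚ qs))

oneₚ : Poly
oneₚ = + 1 ∷ []

mono : ℕ → Poly
mono m = replicate m (+ 0) ++ (+ 1 ∷ [])

-- equality of polynomials (coefficientwise, so trailing zeros are irrelevant)
_≈ₚ_ : Poly → Poly → Set
P ≈ₚ Q = ∀ m → coeff P m ≡ coeff Q m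

_∣ₚ_ : Poly → Poly → Set
D ∣ₚ P = Σ Poly (λ Q → P ≈ₚ (D *ₚ Q))

qInt : ℕ → ℕ → Poly
qInt k a = foldr (λ t acc → mono (t ℕ.* a) +ₚ acc) [] (upTo k)

qIntProd : ℕ → ℕ → Poly
qIntProd k zero    = oneₚ
qIntProd k (suc n) = qIntProd k n *ₚ qInt k (suc n)

words : ℕ → ℕ → List (List ℕ)
words N zero      = [] ∷ []
words N (suc len) =
  concatMap (λ a → map (a ∷_) (words N len)) (map suc (upTo N))

notIn : ℕ → List ℕ → Bool
notIn x []       = true
notIn x (y ∷ ys) = not (x ≡ᵇ y) ∧ notIn x ys

distinct : List ℕ → Bool
distinct []       = true
distinct (x ∷ xs) = notIn x xs ∧ distinct xs

permutations : ℕ → List (List ℕ)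
permutations N = filter (λ w → Data.Bool._≟_ (distinct w) true) (words N N)
  where import Data.Bool

countLess : ℕ → List ℕ → ℕ
countLess x []       = 0
countLess x (y ∷ ys) = (if y <ᵇ x then 1 else 0) ℕ.+ countLess x ys

inv : List ℕ → ℕ
inv []       = 0
inv (x ∷ xs) = countLess x xs ℕ.+ inv xs

-- Des(π) = {j : 1 ≤ j < N} ∩ kℤ, checked position by position.
-- desCheck k j w : the word w starts at position j (1-based); for every
-- adjacent pair (a_m , a_{m+1}) in w we require  a_m > a_{m+1}  ⇔  k ∣ m.
desCheck : ℕ → ℕ → List ℕ → Bool
desCheck k j []            = true
desCheck k j (x ∷ [])      = true
desCheck k j (x ∷ y ∷ ys)  =
  ((y <ᵇ x) Data.Bool.xor not ⌊ k ∣? j ⌋ ) ∧ desCheck k (suc j) (y ∷ ys)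
  where import Data.Bool

hasDesSet : ℕ → List ℕ → Bool
hasDesSet k w = desCheck k 1 w

qEuler : ℕ → ℕ → Poly
qEuler N k =
  foldr (λ w acc → (if hasDesSet k w then mono (inv w) else []) +ₚ acc)
        [] (permutations N)

{-# OPTIONS --safe #-}
module Submission where

-- Let A = ℤ[[q]], (q)_N = (1 - q)⋯(1 - q^N), and e(y) = Σ y^N / (q)_N in A[[y]]. Counting by inclusion–exclusion
-- shows that 1 plus the sum of ± E_{N|k}(q) y^N / (q)_N over k ∤ N is the series ρ = e / B, where B is the part of e
-- supported on exponents divisible by k. Since y e′ = e L with L = Σ y^m / (1 - q^m), the terms
-- of L with k ∣ m contribute equally to the logarithmic derivatives of e and of B, so ρ satisfies a Riccati equation
-- involving only the 1 / (1 - q^m) with k ∤ m. Hence E_{N|k} / (q)_N is a polynomial divided by a product of positive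
-- integers and factors 1 - q^m with k ∤ m. As (q)_N is a multiple of [k]_q ⋯ [k]_{q^n}, it remains to cancel that
-- denominator: k lies in the ideal ([k]_{q^a}, 1 - q^m) of ℤ[q], and ℤ[[q]] / ℤ[q] is torsion-free.

open import Defs
open import Level using (Level; 0ℓ; _⊔_) renaming (suc to lsuc)
open import Function using (_∘_; id)
open import Data.Bool using (Bool; true; false; if_then_else_; not; _∧_; _xor_)
open import Data.Empty using (⊥-elim)
import Data.Integer as ℤ
import Data.Integer.Properties as ℤ
open import Data.List using (List; []; _∷_; _++_; map; foldr; concatMap; filter; length; applyUpTo; upTo)
open import Data.Nat as ℕ using (ℕ; zero; suc; z≤n; s≤s; _<ᵇ_; _≡ᵇ_)
import Data.Nat.Properties as ℕ
open import Data.Nat.Coprimality using (Coprime; coprime-Bézout)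
open import Data.Nat.Divisibility using (_∣_; _∣?_; _∣0; n∣m*n; ∣-refl; ∣m∣n⇒∣m+n; ∣m+n∣m⇒∣n; >⇒∤)
open import Data.Nat.GCD using (module Bézout)
open import Data.Nat.Primality using (Prime; prime⇒irreducible; prime⇒nonZero)
open import Data.Nat.Solver using (module +-*-Solver)
open import Data.Product using (∃; ∃₂; _,_) renaming (_×_ to _And_)
open import Data.Sum using (inj₁; inj₂)
open import Relation.Nullary using (¬_; Dec; yes; no)
open import Relation.Nullary.Decidable using (⌊_⌋; dec-true; dec-false)
open import Relation.Binary.PropositionalEquality as ≡ using (_≡_)
open import Algebra.Bundles using (CommutativeRing)
import Algebra.Construct.Pointwise as Pointwise
import Algebra.Properties.CommutativeMonoid.Mult as CommutativeMonoidMult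
import Algebra.Properties.Group as GroupProperties
import Algebra.Properties.Ring as RingProperties
import Algebra.Properties.Semiring.Exp as Exp
import Algebra.Properties.Semiring.Mult as Mult
import Algebra.Solver.Ring.NaturalCoefficients.Default as Solver
import Relation.Binary.Reasoning.Setoid as SetoidReasoning

-- The recursion read off from `ρ ⊛ B = e` has every 1 - q^m in its denominators, and for k ∣ m this
-- factor is a multiple of [k] at q^(m/k), one of the very polynomials whose divisibility is at
-- stake. Passing to logarithmic derivatives removes exactly these m. The price is a division by n
-- at the n-th coefficient, which is harmless over ℤ[q]. The polynomials [k]_{q^a} are not pairwise
-- coprime: 1 + q^2 + q^4 is a multiple of 1 + q + q^2. So divisibility by each of them would not
-- give divisibility by the product. Instead the full quotient is written down in ℤ[[q]] and shown
-- to be a polynomial, because its multiples by the product and by the denominator both are.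
-- Primality of k makes k coprime to every j that it does not divide.

private module ℕS = +-*-Solver

-- `÷-closed` says that the quotient by the subring is torsion-free, the property that survives the
-- divisions by integers. The notion has two instances: ℤ[q] inside ℤ[[q]], and the elements that
-- reach a given subring after multiplication by an admissible denominator.
record SaturatedSubring {c ℓ} (R : CommutativeRing c ℓ) (p : Level) : Set (c ⊔ ℓ ⊔ lsuc p) where
  open CommutativeRing R
  open Mult semiring using (_×_)
  field
    Mem      : Carrier → Set p
    resp     : ∀ {x y} → x ≈ y → Mem x → Mem y
    1-closed : Mem 1#
    +-closed : ∀ {x y} → Mem x → Mem y → Mem (x + y)
    neg-closed : ∀ {x} → Mem x → Mem (- x)
    *-closed : ∀ {x y} → Mem x → Mem y → Mem (x * y)
    ÷-closed : ∀ n {x} → Mem (suc n × x) → Mem x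

  0-closed : Mem 0#
  0-closed = resp (-‿inverseʳ 1#) (+-closed 1-closed (neg-closed 1-closed))

-- A ring with an element q for which every 1 - q^(n+1) is invertible, with inverse geo n.
record QRing (c ℓ : Level) : Set (lsuc (c ⊔ ℓ)) where
  field
    R : CommutativeRing c ℓ
  open CommutativeRing R public
  open Exp semiring using (_^_) public
  field
    q          : Carrier
    geo        : ℕ → Carrier
    geo-unfold : ∀ n → geo n ≈ 1# + q ^ suc n * geo n

-- Formal power series in y over a commutative ring.

module PowerSeries {c ℓ} (R : CommutativeRing c ℓ) where

  open CommutativeRing R
  open Mult semiring using (_×_; ×-congʳ; ×-comm-*)
  open Solver commutativeSemiring using (solve; _:=_; _:+_; _:*_)
  open SetoidReasoning setoid

  Series : Set c
  Series = ℕ → Carrier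

  infix  4 _≋_
  infixl 7 _⊛_
  infixl 6 _⊕_

  _≋_ : Series → Series → Set ℓ
  f ≋ g = ∀ n → f n ≈ g n

  _⊕_ : Series → Series → Series
  (f ⊕ g) n = f n + g n

  tail : Series → Series
  tail f = f ∘ suc

  _⊛_ : Series → Series → Series
  (f ⊛ g) zero    = f 0 * g 0
  (f ⊛ g) (suc n) = f 0 * g (suc n) + (tail f ⊛ g) n

  constant : Carrier → Series
  constant a zero    = a
  constant a (suc n) = 0#

  var : Series
  var zero          = 0#
  var (suc zero)    = 1#
  var (suc (suc n)) = 0#

  ⊛-cong : ∀ {f f′ g g′} → f ≋ f′ → g ≋ g′ → f ⊛ g ≋ f′ ⊛ g′
  ⊛-cong p r zero    = *-cong (p 0) (r 0)
  ⊛-cong p r (suc n) = +-cong (*-cong (p 0) (r (suc n))) (⊛-cong (p ∘ suc) r n)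

  ⊛-zeroˡ : ∀ {f} g → f ≋ (λ _ → 0#) → f ⊛ g ≋ (λ _ → 0#)
  ⊛-zeroˡ g p zero    = trans (*-congʳ (p 0)) (zeroˡ _)
  ⊛-zeroˡ g p (suc n) = trans (+-cong (trans (*-congʳ (p 0)) (zeroˡ _)) (⊛-zeroˡ g (p ∘ suc) n)) (+-identityˡ _)

  ⊛-constantˡ : ∀ a f → constant a ⊛ f ≋ (λ n → a * f n)
  ⊛-constantˡ a f zero    = refl
  ⊛-constantˡ a f (suc n) = trans (+-congˡ (⊛-zeroˡ f (λ _ → refl) n)) (+-identityʳ _)

  ⊛-distribʳ : ∀ h f g → (f ⊕ g) ⊛ h ≋ f ⊛ h ⊕ g ⊛ h
  ⊛-distribʳ h f g zero    = distribʳ _ _ _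
  ⊛-distribʳ h f g (suc n) = begin
    (f 0 + g 0) * h (suc n) + ((tail f ⊕ tail g) ⊛ h) n               ≈⟨ +-congˡ (⊛-distribʳ h (tail f) (tail g) n) ⟩
    (f 0 + g 0) * h (suc n) + ((tail f ⊛ h) n + (tail g ⊛ h) n)       ≈⟨ solve 5 (λ a b x y z → (a :+ b) :* x :+ (y :+ z) := a :* x :+ y :+ (b :* x :+ z)) refl _ _ _ _ _ ⟩
    f 0 * h (suc n) + (tail f ⊛ h) n + (g 0 * h (suc n) + (tail g ⊛ h) n)  ∎

  ⊛-scaleˡ : ∀ a f g → (λ n → a * f n) ⊛ g ≋ (λ n → a * (f ⊛ g) n)
  ⊛-scaleˡ a f g zero    = *-assoc _ _ _
  ⊛-scaleˡ a f g (suc n) = trans (+-cong (*-assoc _ _ _) (⊛-scaleˡ a (tail f) g n)) (sym (distribˡ _ _ _))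

  ⊛-assoc : ∀ f g h → (f ⊛ g) ⊛ h ≋ f ⊛ (g ⊛ h)
  ⊛-assoc f g h zero    = *-assoc _ _ _
  ⊛-assoc f g h (suc n) = begin
    f 0 * g 0 * h (suc n) + (tail (f ⊛ g) ⊛ h) n
      ≈⟨ +-congˡ (⊛-distribʳ h (λ m → f 0 * g (suc m)) (tail f ⊛ g) n) ⟩
    f 0 * g 0 * h (suc n) + (((λ m → f 0 * g (suc m)) ⊛ h) n + ((tail f ⊛ g) ⊛ h) n)
      ≈⟨ +-congˡ (+-cong (⊛-scaleˡ (f 0) (tail g) h n) (⊛-assoc (tail f) g h n)) ⟩
    f 0 * g 0 * h (suc n) + (f 0 * (tail g ⊛ h) n + (tail f ⊛ (g ⊛ h)) n)
      ≈⟨ solve 5 (λ a b x y z → a :* b :* x :+ (a :* y :+ z) := a :* (b :* x :+ y) :+ z) refl _ _ _ _ _ ⟩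
    f 0 * (g ⊛ h) (suc n) + (tail f ⊛ (g ⊛ h)) n  ∎

  ⊛-unfoldʳ : ∀ f g n → (f ⊛ g) (suc n) ≈ f (suc n) * g 0 + (f ⊛ tail g) n
  ⊛-unfoldʳ f g zero    = +-comm _ _
  ⊛-unfoldʳ f g (suc n) = begin
    f 0 * g (suc (suc n)) + (tail f ⊛ g) (suc n)                              ≈⟨ +-congˡ (⊛-unfoldʳ (tail f) g n) ⟩
    f 0 * g (suc (suc n)) + (f (suc (suc n)) * g 0 + (tail f ⊛ tail g) n)     ≈⟨ solve 3 (λ x y z → x :+ (y :+ z) := y :+ (x :+ z)) refl _ _ _ ⟩
    f (suc (suc n)) * g 0 + (f 0 * g (suc (suc n)) + (tail f ⊛ tail g) n)     ∎

  ⊛-comm : ∀ f g → f ⊛ g ≋ g ⊛ f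
  ⊛-comm f g zero    = *-comm _ _
  ⊛-comm f g (suc n) = begin
    f 0 * g (suc n) + (tail f ⊛ g) n  ≈⟨ +-cong (*-comm _ _) (⊛-comm (tail f) g n) ⟩
    g (suc n) * f 0 + (g ⊛ tail f) n  ≈⟨ ⊛-unfoldʳ g f n ⟨
    (g ⊛ f) (suc n)                   ∎

  seriesRing : CommutativeRing c ℓ
  seriesRing = record
    { Carrier = Series
    ; _≈_     = _≋_
    ; _+_     = _⊕_
    ; _*_     = _⊛_
    ; -_      = λ f n → - f n
    ; 0#      = λ _ → 0#
    ; 1#      = constant 1#
    ; isCommutativeRing = record
      { isRing = record
        { +-isAbelianGroup = Pointwise.isAbelianGroup ℕ +-isAbelianGroup
        ; *-cong           = ⊛-cong
        ; *-assoc          = ⊛-assoc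
        ; *-identity       = identityˡ , λ f n → trans (⊛-comm f (constant 1#) n) (identityˡ f n)
        ; distrib          = (λ h f g n → trans (⊛-comm h (f ⊕ g) n) (trans (⊛-distribʳ h f g n) (+-cong (⊛-comm f h n) (⊛-comm g h n)))) , ⊛-distribʳ
        }
      ; *-comm = ⊛-comm
      }
    }
    where
    identityˡ : ∀ f → constant 1# ⊛ f ≋ f
    identityˡ f n = trans (⊛-constantˡ 1# f n) (*-identityˡ _)

  var-⊛-zero : ∀ f → (var ⊛ f) 0 ≈ 0#
  var-⊛-zero f = zeroˡ _

  var-⊛-suc : ∀ f n → (var ⊛ f) (suc n) ≈ f n
  var-⊛-suc f n = begin
    0# * f (suc n) + (tail var ⊛ f) n  ≈⟨ +-cong (zeroˡ _) (⊛-cong {g = f} tail-var (λ _ → refl) n) ⟩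
    0# + (constant 1# ⊛ f) n           ≈⟨ +-identityˡ _ ⟩
    (constant 1# ⊛ f) n                ≈⟨ ⊛-constantˡ 1# f n ⟩
    1# * f n                           ≈⟨ *-identityˡ _ ⟩
    f n                                ∎
    where
    tail-var : tail var ≋ constant 1#
    tail-var zero    = refl
    tail-var (suc n) = refl

  -- Constant term 1 forces the constant terms of f and g to agree; once these are subtracted, the
  -- tails satisfy the same hypothesis.
  ⊛-cancelʳ : ∀ B → B 0 ≈ 1# → ∀ f g → f ⊛ B ≋ g ⊛ B → f ≋ g
  ⊛-cancelʳ B B₀≈1 f g fB≋gB zero = begin
    f 0        ≈⟨ *-identityʳ _ ⟨
    f 0 * 1#   ≈⟨ *-congˡ B₀≈1 ⟨
    f 0 * B 0  ≈⟨ fB≋gB 0 ⟩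
    g 0 * B 0  ≈⟨ *-congˡ B₀≈1 ⟩
    g 0 * 1#   ≈⟨ *-identityʳ _ ⟩
    g 0        ∎
  ⊛-cancelʳ B B₀≈1 f g fB≋gB (suc n) = ⊛-cancelʳ B B₀≈1 (tail f) (tail g) tails n
    where
    open GroupProperties +-group using (∙-cancelˡ)
    tails : tail f ⊛ B ≋ tail g ⊛ B
    tails m = ∙-cancelˡ (f 0 * B (suc m)) _ _
      (trans (fB≋gB (suc m)) (+-congʳ (*-congʳ (sym (⊛-cancelʳ B B₀≈1 f g fB≋gB 0)))))

  -- The derivation y d/dy: unlike d/dy it shifts no exponents, so it commutes with `multiples`.
  D : Series → Series
  D f n = n × f n

  D-cong : ∀ {f g} → f ≋ g → D f ≋ D g
  D-cong f≋g n = ×-congʳ n (f≋g n)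

  D-⊛ : ∀ f g → D (f ⊛ g) ≋ D f ⊛ g ⊕ f ⊛ D g
  D-⊛ f g zero    = sym (trans (+-cong (zeroˡ _) (zeroʳ _)) (+-identityˡ _))
  D-⊛ f g (suc n) = begin
    suc n × (f 0 * g (suc n) + (tail f ⊛ g) n)
      ≈⟨ ×-distrib-+ _ _ (suc n) ⟩
    suc n × (f 0 * g (suc n)) + ((tail f ⊛ g) n + n × (tail f ⊛ g) n)
      ≈⟨ +-cong (sym (×-comm-* (suc n) _ _)) (+-congˡ (D-⊛ (tail f) g n)) ⟩
    f 0 * D g (suc n) + ((tail f ⊛ g) n + ((D (tail f) ⊛ g) n + (tail f ⊛ D g) n))
      ≈⟨ solve 4 (λ a x y z → a :+ (x :+ (y :+ z)) := x :+ y :+ (a :+ z)) refl _ _ _ _ ⟩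
    (tail f ⊛ g) n + (D (tail f) ⊛ g) n + (f ⊛ D g) (suc n)
      ≈⟨ +-congʳ (⊛-distribʳ g (tail f) (D (tail f)) n) ⟨
    (tail (D f) ⊛ g) n + (f ⊛ D g) (suc n)
      ≈⟨ +-congʳ (trans (+-congʳ (zeroˡ _)) (+-identityˡ _)) ⟨
    (D f ⊛ g) (suc n) + (f ⊛ D g) (suc n) ∎
    where
    open CommutativeMonoidMult +-commutativeMonoid using (×-distrib-+)

-- Splitting a series by divisibility of its exponents by k, and the Riccati equation.

module Decimation {c ℓ} (R : CommutativeRing c ℓ) (k : ℕ) where

  open PowerSeries R

  open CommutativeRing R
  module S = CommutativeRing seriesRing
  open Mult semiring using (_×_; ×-congʳ; ×-assoc-*)

  multiples others : Series → Series
  multiples f n = if ⌊ k ∣? n ⌋ then f n else 0#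
  others    f n = if ⌊ k ∣? n ⌋ then 0# else f n

  multiples-yes : ∀ f {n} → k ∣ n → multiples f n ≡ f n
  multiples-yes f {n} k∣n with k ∣? n
  ... | yes _   = ≡.refl
  ... | no  k∤n = ⊥-elim (k∤n k∣n)

  multiples-no : ∀ f {n} → ¬ k ∣ n → multiples f n ≡ 0#
  multiples-no f {n} k∤n with k ∣? n
  ... | yes k∣n = ⊥-elim (k∤n k∣n)
  ... | no  _   = ≡.refl

  multiples-cong : ∀ {f g} → f ≋ g → multiples f ≋ multiples g
  multiples-cong f≋g n with k ∣? n
  ... | yes _ = f≋g n
  ... | no  _ = refl

  multiples-⊕ : ∀ f g → multiples (f ⊕ g) ≋ multiples f ⊕ multiples g
  multiples-⊕ f g n with k ∣? n
  ... | yes _ = refl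
  ... | no  _ = sym (+-identityˡ _)

  multiples⊕others : ∀ f → f ≋ multiples f ⊕ others f
  multiples⊕others f n with k ∣? n
  ... | yes _ = sym (+-identityʳ _)
  ... | no  _ = sym (+-identityˡ _)

  D-multiples : ∀ f → D (multiples f) ≋ multiples (D f)
  D-multiples f n with k ∣? n
  ... | yes _ = refl
  ... | no  _ = trans (sym (×-congʳ n (zeroˡ 0#))) (trans (sym (×-assoc-* n 0# 0#)) (zeroʳ _))

  -- The offset j is what makes the induction along the tail of f go through.
  multiples-⊛-offset : ∀ j f g → (∀ m → ¬ k ∣ j ℕ.+ m → f m ≈ 0#) → ∀ n →
    (if ⌊ k ∣? j ℕ.+ n ⌋ then (f ⊛ g) n else 0#) ≈ (f ⊛ multiples g) n
  multiples-⊛-offset j f g supp = go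
    where
    if-zero : ∀ m {x} → x ≈ 0# → (if ⌊ k ∣? m ⌋ then x else 0#) ≈ 0#
    if-zero m x≈0 with k ∣? m
    ... | yes _ = x≈0
    ... | no  _ = refl

    if-+ : ∀ m x y → (if ⌊ k ∣? m ⌋ then x + y else 0#) ≈
                     (if ⌊ k ∣? m ⌋ then x else 0#) + (if ⌊ k ∣? m ⌋ then y else 0#)
    if-+ m x y with k ∣? m
    ... | yes _ = refl
    ... | no  _ = sym (+-identityˡ _)

    vanish : ∀ {x y} → x ≈ 0# → x * y ≈ 0#
    vanish x≈0 = trans (*-congʳ x≈0) (zeroˡ _)

    head : ∀ m → (if ⌊ k ∣? j ℕ.+ m ⌋ then f 0 * g m else 0#) ≈ f 0 * multiples g m
    head m with k ∣? j
    head m | no k∤j = trans (if-zero (j ℕ.+ m) (vanish f₀≈0)) (sym (vanish f₀≈0))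
      where
      f₀≈0 : f 0 ≈ 0#
      f₀≈0 = supp 0 (k∤j ∘ ≡.subst (k ∣_) (ℕ.+-identityʳ j))
    head m | yes k∣j with k ∣? j ℕ.+ m | k ∣? m
    ... | yes _  | yes _  = refl
    ... | no  _  | no  _  = sym (zeroʳ _)
    ... | yes p  | no  ¬p = ⊥-elim (¬p (∣m+n∣m⇒∣n p k∣j))
    ... | no  ¬p | yes p  = ⊥-elim (¬p (∣m∣n⇒∣m+n k∣j p))

    go : ∀ n → (if ⌊ k ∣? j ℕ.+ n ⌋ then (f ⊛ g) n else 0#) ≈ (f ⊛ multiples g) n
    go zero    = head 0
    go (suc n) = trans (if-+ (j ℕ.+ suc n) _ _) (+-cong (head (suc n)) rest)
      where
      rest : (if ⌊ k ∣? j ℕ.+ suc n ⌋ then (tail f ⊛ g) n else 0#) ≈ (tail f ⊛ multiples g) n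
      rest rewrite ℕ.+-suc j n = multiples-⊛-offset (suc j) (tail f) g
        (λ m k∤ → supp (suc m) (k∤ ∘ ≡.subst (k ∣_) (ℕ.+-suc j m))) n

  -- Linearity over series in y^k: multiplying by y^m with k ∣ m does not change which exponents are
  -- multiples of k.
  multiples-⊛ : ∀ f g → (∀ m → ¬ k ∣ m → f m ≈ 0#) → multiples (f ⊛ g) ≋ f ⊛ multiples g
  multiples-⊛ f g supp = multiples-⊛-offset 0 f g supp

  -- With B the part of e supported on multiples of k, the logarithmic derivatives of e and B
  -- share the summand multiples L, which therefore drops out for the ratio ρ = e / B.
  riccati : ∀ e L ρ → e 0 ≈ 1# → D e ≋ e ⊛ L → ρ ⊛ multiples e ≋ e →
    D ρ ⊕ ρ ⊛ multiples (ρ ⊛ others L) ≋ ρ ⊛ others L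
  riccati e L ρ e₀≈1 De≋eL ρB≋e = ⊛-cancelʳ B B₀≈1 _ _
    (⊕-cancelʳ (ρ ⊛ (B ⊛ M)) _ _ main)
    where
    open SetoidReasoning S.setoid
    open Solver S.commutativeSemiring using (solve; _:=_; _:+_; _:*_)
    open GroupProperties S.+-group using () renaming (∙-cancelʳ to ⊕-cancelʳ)

    B M O P : Series
    B = multiples e
    M = multiples L
    O = others L
    P = multiples (ρ ⊛ O)

    B₀≈1 : B 0 ≈ 1#
    B₀≈1 = trans (reflexive (multiples-yes e (k ∣0))) e₀≈1

    De : D e ≋ ρ ⊛ B ⊛ (M ⊕ O)
    De = begin
      D e              ≈⟨ De≋eL ⟩
      e ⊛ L            ≈⟨ S.*-cong (S.sym ρB≋e) (multiples⊕others L) ⟩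
      ρ ⊛ B ⊛ (M ⊕ O)  ∎

    B-supp : ∀ m → ¬ k ∣ m → B m ≈ 0#
    B-supp m k∤m = reflexive (multiples-no e k∤m)

    M-supp : ∀ m → ¬ k ∣ m → M m ≈ 0#
    M-supp m k∤m = reflexive (multiples-no L k∤m)

    -- The two parts of `L` leave `multiples` by different routes: `M` is itself a series in y^k,
    -- whereas in `e ⊛ O` the factor `B` of `e` is the one pulled out.
    DB : D B ≋ B ⊛ M ⊕ B ⊛ P
    DB = begin
      D B                                        ≈⟨ D-multiples e ⟩
      multiples (D e)                            ≈⟨ multiples-cong De≋eL ⟩
      multiples (e ⊛ L)                          ≈⟨ multiples-cong (S.*-congˡ {e} (multiples⊕others L)) ⟩
      multiples (e ⊛ (M ⊕ O))                    ≈⟨ multiples-cong (S.distribˡ e M O) ⟩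
      multiples (e ⊛ M ⊕ e ⊛ O)                  ≈⟨ multiples-⊕ (e ⊛ M) (e ⊛ O) ⟩
      multiples (e ⊛ M) ⊕ multiples (e ⊛ O)      ≈⟨ S.+-cong (multiples-cong (S.*-comm e M)) (multiples-cong (S.*-congʳ {O} (S.sym ρB≋e))) ⟩
      multiples (M ⊛ e) ⊕ multiples (ρ ⊛ B ⊛ O)  ≈⟨ S.+-cong (multiples-⊛ M e M-supp) (multiples-cong (solve 3 (λ x y z → x :* y :* z := y :* (x :* z)) S.refl ρ B O)) ⟩
      M ⊛ B ⊕ multiples (B ⊛ (ρ ⊛ O))            ≈⟨ S.+-cong (S.*-comm M B) (multiples-⊛ B (ρ ⊛ O) B-supp) ⟩
      B ⊛ M ⊕ B ⊛ P                              ∎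

    main : (D ρ ⊕ ρ ⊛ P) ⊛ B ⊕ ρ ⊛ (B ⊛ M) ≋ (ρ ⊛ O) ⊛ B ⊕ ρ ⊛ (B ⊛ M)
    main = begin
      (D ρ ⊕ ρ ⊛ P) ⊛ B ⊕ ρ ⊛ (B ⊛ M)
        ≈⟨ solve 5 (λ d r p b m → (d :+ r :* p) :* b :+ r :* (b :* m) := d :* b :+ r :* (b :* m :+ b :* p)) S.refl (D ρ) ρ P B M ⟩
      D ρ ⊛ B ⊕ ρ ⊛ (B ⊛ M ⊕ B ⊛ P)   ≈⟨ S.+-congˡ {D ρ ⊛ B} (S.*-congˡ {ρ} (S.sym DB)) ⟩
      D ρ ⊛ B ⊕ ρ ⊛ D B               ≈⟨ D-⊛ ρ B ⟨
      D (ρ ⊛ B)                       ≈⟨ D-cong ρB≋e ⟩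
      D e                             ≈⟨ De ⟩
      ρ ⊛ B ⊛ (M ⊕ O)
        ≈⟨ solve 4 (λ r b m o → r :* b :* (m :+ o) := r :* o :* b :+ r :* (b :* m)) S.refl ρ B M O ⟩
      (ρ ⊛ O) ⊛ B ⊕ ρ ⊛ (B ⊛ M)       ∎

  -- The Riccati equation expresses n ρₙ through ρ₀, …, ρₙ₋₁ and the others L.
  riccati-closed : ∀ {p} (G : SaturatedSubring R p) → let open SaturatedSubring G in ∀ L ρ → L 0 ≈ 0# → Mem (ρ 0) → (∀ n → Mem (others L n)) →
    D ρ ⊕ ρ ⊛ multiples (ρ ⊛ others L) ≋ ρ ⊛ others L →
    ∀ n → Mem (ρ n)
  riccati-closed G L ρ L₀≈0 ρ₀∈ L∈ eq n = below (suc n) n (ℕ.n<1+n n)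
    where
    open SaturatedSubring G
    open SetoidReasoning setoid
    O = others L
    P = multiples (ρ ⊛ O)

    conv : ∀ f g n → (∀ m → m ℕ.≤ n → Mem (f m)) → (∀ m → m ℕ.≤ n → Mem (g m)) → Mem ((f ⊛ g) n)
    conv f g zero    Gf Gg = *-closed (Gf 0 ℕ.z≤n) (Gg 0 ℕ.z≤n)
    conv f g (suc n) Gf Gg = +-closed (*-closed (Gf 0 ℕ.z≤n) (Gg (suc n) ℕ.≤-refl))
      (conv (tail f) g n (λ m m≤n → Gf (suc m) (ℕ.s≤s m≤n)) (λ m m≤n → Gg m (ℕ.m≤n⇒m≤1+n m≤n)))

    -- A vanishing constant term of g removes the top coefficient of f from the convolution. With f
    -- = ρ this makes the right-hand sides involve earlier coefficients only.
    conv₀ : ∀ f g n → g 0 ≈ 0# → (∀ m → m ℕ.≤ n → Mem (f m)) → (∀ m → m ℕ.≤ suc n → Mem (g m)) → Mem ((f ⊛ g) (suc n))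
    conv₀ f g n g₀≈0 Gf Gg = resp (sym eq₀) (conv f (tail g) n Gf (λ m m≤n → Gg (suc m) (ℕ.s≤s m≤n)))
      where
      eq₀ : (f ⊛ g) (suc n) ≈ (f ⊛ tail g) n
      eq₀ = begin
        (f ⊛ g) (suc n)                     ≈⟨ ⊛-unfoldʳ f g n ⟩
        f (suc n) * g 0 + (f ⊛ tail g) n    ≈⟨ +-congʳ (*-congˡ g₀≈0) ⟩
        f (suc n) * 0# + (f ⊛ tail g) n     ≈⟨ +-congʳ (zeroʳ _) ⟩
        0# + (f ⊛ tail g) n                 ≈⟨ +-identityˡ _ ⟩
        (f ⊛ tail g) n                      ∎

    O₀≈0 : O 0 ≈ 0#
    O₀≈0 with k ∣? 0
    ... | yes _ = refl
    ... | no  _ = L₀≈0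

    P₀≈0 : P 0 ≈ 0#
    P₀≈0 = trans (reflexive (multiples-yes (ρ ⊛ O) (k ∣0))) (trans (*-congˡ O₀≈0) (zeroʳ _))

    -- Strong induction, with N as the bound. Every coefficient needed for ρ at `suc m` has index at
    -- most m, since `O` and `P` both start with 0.
    below : ∀ N m → m ℕ.< N → Mem (ρ m)
    below (suc N) zero    _             = ρ₀∈
    below (suc N) (suc m) (ℕ.s≤s m<N) = ÷-closed m (resp difference (+-closed (GρO (suc m) ℕ.≤-refl) (neg-closed (conv₀ ρ P m P₀≈0 Gρ GP))))
      where
      Gρ : ∀ l → l ℕ.≤ m → Mem (ρ l)
      Gρ l l≤m = below N l (ℕ.≤-<-trans l≤m m<N)
      GρO : ∀ l → l ℕ.≤ suc m → Mem ((ρ ⊛ O) l)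
      GρO zero    _             = resp (sym (trans (*-congˡ O₀≈0) (zeroʳ _))) 0-closed
      GρO (suc l) (ℕ.s≤s l≤m) = conv₀ ρ O l O₀≈0 (λ j j≤l → Gρ j (ℕ.≤-trans j≤l l≤m)) (λ j _ → L∈ j)
      GP : ∀ l → l ℕ.≤ suc m → Mem (P l)
      GP l l≤ with k ∣? l
      ... | yes _ = GρO l l≤
      ... | no  _ = 0-closed
      difference : (ρ ⊛ O) (suc m) + - (ρ ⊛ P) (suc m) ≈ suc m × ρ (suc m)
      difference = begin
        (ρ ⊛ O) (suc m) + - (ρ ⊛ P) (suc m)                       ≈⟨ +-congʳ (eq (suc m)) ⟨
        D ρ (suc m) + (ρ ⊛ P) (suc m) + - (ρ ⊛ P) (suc m)         ≈⟨ +-assoc _ _ _ ⟩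
        D ρ (suc m) + ((ρ ⊛ P) (suc m) + - (ρ ⊛ P) (suc m))       ≈⟨ +-congˡ (-‿inverseʳ _) ⟩
        D ρ (suc m) + 0#                                          ≈⟨ +-identityʳ _ ⟩
        D ρ (suc m)                                               ∎

-- The q-exponential, its logarithmic derivative, and Gaussian binomials.

module QExponential {c ℓ} (Q : QRing c ℓ) where

  open QRing Q
  open PowerSeries R

  private module S = CommutativeRing seriesRing
  open Exp semiring using (^-homo-*)
  open Mult semiring using (_×_; ×-assoc-*)
  open Solver commutativeSemiring using (solve; _:=_; _:+_; _:*_; con)

  -- The hypothesis reads (1 - q^(n+1)) x = a. In this fixed-point form two quantities are proved
  -- equal, without subtraction, by exhibiting the same a for both.
  geo-unique : ∀ n {x a} → x ≈ a + q ^ suc n * x → x ≈ a * geo n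
  geo-unique n {x} {a} x-eq = ∙-cancelʳ (x * (q ^ suc n * geo n)) _ _ (begin
    x + x * (q ^ suc n * geo n)               ≈⟨ solve 2 (λ x y → x :+ x :* y := x :* (con 1 :+ y)) refl _ _ ⟩
    x * (1# + q ^ suc n * geo n)              ≈⟨ *-cong x-eq (sym (geo-unfold n)) ⟩
    (a + q ^ suc n * x) * geo n               ≈⟨ solve 4 (λ a p x g → (a :+ p :* x) :* g := a :* g :+ x :* (p :* g)) refl _ _ _ _ ⟩
    a * geo n + x * (q ^ suc n * geo n)       ∎)
    where
    open SetoidReasoning setoid
    open GroupProperties +-group using (∙-cancelʳ)

  qexp : Series
  qexp zero    = 1#
  qexp (suc n) = qexp n * geo n

  qexp-unfold : ∀ n → qexp (suc n) ≈ qexp n + q ^ suc n * qexp (suc n)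
  qexp-unfold n = begin
    qexp n * geo n                          ≈⟨ *-congˡ (geo-unfold n) ⟩
    qexp n * (1# + q ^ suc n * geo n)       ≈⟨ solve 3 (λ e p g → e :* (con 1 :+ p :* g) := e :+ p :* (e :* g)) refl _ _ _ ⟩
    qexp n + q ^ suc n * (qexp n * geo n)   ∎
    where open SetoidReasoning setoid

  qlog : Series
  qlog zero    = 0#
  qlog (suc n) = geo n

  -- The substitution f(y) ↦ f(qy).
  dilate : Series → Series
  dilate f n = q ^ n * f n

  dilate-⊛ : ∀ f g → dilate (f ⊛ g) ≋ dilate f ⊛ dilate g
  dilate-⊛ f g zero    = solve 2 (λ x y → con 1 :* (x :* y) := con 1 :* x :* (con 1 :* y)) refl _ _
  dilate-⊛ f g (suc n) = begin
    q * q ^ n * (f 0 * g (suc n) + (tail f ⊛ g) n)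
      ≈⟨ solve 5 (λ q p x y z → q :* p :* (x :* y :+ z) := con 1 :* x :* (q :* p :* y) :+ q :* (p :* z)) refl _ _ _ _ _ ⟩
    1# * f 0 * (q * q ^ n * g (suc n)) + q * (q ^ n * (tail f ⊛ g) n)
      ≈⟨ +-congˡ (*-congˡ (dilate-⊛ (tail f) g n)) ⟩
    1# * f 0 * (q * q ^ n * g (suc n)) + q * (dilate (tail f) ⊛ dilate g) n
      ≈⟨ +-congˡ (⊛-scaleˡ q (dilate (tail f)) (dilate g) n) ⟨
    1# * f 0 * (q * q ^ n * g (suc n)) + ((λ m → q * dilate (tail f) m) ⊛ dilate g) n
      ≈⟨ +-congˡ (⊛-cong {g = dilate g} (λ m → sym (*-assoc q (q ^ m) (f (suc m)))) (λ _ → refl) n) ⟩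
    (dilate f ⊛ dilate g) (suc n) ∎
    where open SetoidReasoning setoid

  -- The q-difference equations qexp(qy) = (1 - y) qexp(y) and qlog(qy) = qlog(y) - y/(1 - y)
  -- give one for the product that D qexp satisfies as well.
  D-qexp : D qexp ≋ qexp ⊛ qlog
  D-qexp zero    = sym (zeroʳ _)
  D-qexp (suc n) = begin
    suc n × (qexp n * geo n)         ≈⟨ ×-assoc-* (suc n) (qexp n) (geo n) ⟨
    (qexp n + n × qexp n) * geo n    ≈⟨ *-congʳ (trans (+-congˡ (D-qexp n)) (+-comm _ _)) ⟩
    (X n + qexp n) * geo n           ≈⟨ geo-unique n X-suc ⟨
    X (suc n)                        ∎
    where
    open SetoidReasoning setoid
    X ones : Series
    X = qexp ⊛ qlog
    ones zero    = 0#
    ones (suc _) = 1#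

    qexp-dilate : qexp ≋ dilate qexp ⊕ var ⊛ qexp
    qexp-dilate zero    = sym (trans (+-cong (*-identityˡ _) (var-⊛-zero qexp)) (+-identityʳ _))
    qexp-dilate (suc n) = trans (qexp-unfold n) (trans (+-comm _ _) (+-congˡ (sym (var-⊛-suc qexp n))))

    qlog-dilate : qlog ≋ dilate qlog ⊕ ones
    qlog-dilate zero    = sym (trans (+-cong (zeroʳ _) refl) (+-identityʳ _))
    qlog-dilate (suc n) = trans (geo-unfold n) (+-comm _ _)

    ones-unfold : ones ≋ var ⊛ (S.1# ⊕ ones)
    ones-unfold zero    = sym (zeroˡ _)
    ones-unfold (suc n) = sym (trans (var-⊛-suc (S.1# ⊕ ones) n) (all-one n))
      where
      all-one : S.1# ⊕ ones ≋ λ _ → 1#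
      all-one zero    = +-identityʳ _
      all-one (suc _) = +-identityˡ _

    X-dilate : X ≋ dilate X ⊕ var ⊛ (X ⊕ qexp)
    X-dilate = R.begin
      qexp ⊛ qlog
        R.≈⟨ S.*-congˡ {qexp} qlog-dilate ⟩
      qexp ⊛ (dilate qlog ⊕ ones)
        R.≈⟨ S.distribˡ qexp (dilate qlog) ones ⟩
      qexp ⊛ dilate qlog ⊕ qexp ⊛ ones
        R.≈⟨ S.+-cong (S.*-congʳ {dilate qlog} qexp-dilate) (S.*-congˡ {qexp} ones-unfold) ⟩
      (dilate qexp ⊕ var ⊛ qexp) ⊛ dilate qlog ⊕ qexp ⊛ (var ⊛ (S.1# ⊕ ones))
        R.≈⟨ T.solve 5 (λ e′ y e l o → (e′ T.:+ y T.:* e) T.:* l T.:+ e T.:* (y T.:* (T.con 1 T.:+ o))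
                            T.:= e′ T.:* l T.:+ y T.:* (e T.:* (l T.:+ o) T.:+ e))
             S.refl (dilate qexp) var qexp (dilate qlog) ones ⟩
      dilate qexp ⊛ dilate qlog ⊕ var ⊛ (qexp ⊛ (dilate qlog ⊕ ones) ⊕ qexp)
        R.≈⟨ S.+-cong (S.sym (dilate-⊛ qexp qlog)) (S.*-congˡ {var} (S.+-congʳ {qexp} (S.*-congˡ {qexp} (S.sym qlog-dilate)))) ⟩
      dilate X ⊕ var ⊛ (X ⊕ qexp) R.∎
      where
      module R = SetoidReasoning S.setoid
      module T = Solver S.commutativeSemiring

    X-suc : X (suc n) ≈ X n + qexp n + q ^ suc n * X (suc n)
    X-suc = trans (X-dilate (suc n)) (trans (+-congˡ (var-⊛-suc (X ⊕ qexp) n)) (+-comm _ _))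

  -- Gaussian binomials, by the q-Pascal rule in the form that matches splitting off the smallest
  -- admissible first letter in `sum-cell`.
  gauss : ℕ → ℕ → Carrier
  gauss n       zero    = 1#
  gauss zero    (suc m) = 0#
  gauss (suc n) (suc m) = gauss n m + q ^ suc m * gauss n (suc m)

  gauss-> : ∀ {n m} → n ℕ.< m → gauss n m ≈ 0#
  gauss-> {zero}  {suc m} _             = refl
  gauss-> {suc n} {suc m} (ℕ.s≤s n<m) =
    trans (+-cong (gauss-> n<m) (trans (*-congˡ (gauss-> (ℕ.m<n⇒m<1+n n<m))) (zeroʳ _))) (+-identityˡ _)

  gauss-diagonal : ∀ n → gauss n n ≈ 1#
  gauss-diagonal zero    = refl
  gauss-diagonal (suc n) =
    trans (+-cong (gauss-diagonal n) (trans (*-congˡ (gauss-> {n} ℕ.≤-refl)) (zeroʳ _))) (+-identityʳ _)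

  -- The quotient formula (q)_(m+n) / ((q)_m (q)_n) with the divisions cleared. Both sides solve the
  -- same equation of `geo-unique`, on the left by q-Pascal and on the right by unfolding one factor
  -- after the other.
  gauss-qexp : ∀ m n → gauss (m ℕ.+ n) m * qexp (m ℕ.+ n) ≈ qexp m * qexp n
  gauss-qexp zero    n       = refl
  gauss-qexp (suc m) zero    rewrite ℕ.+-identityʳ m =
    trans (*-congʳ (gauss-diagonal (suc m))) (*-comm _ _)
  gauss-qexp (suc m) (suc n) = trans (geo-unique N lhs) (sym (geo-unique N rhs))
    where
    open SetoidReasoning setoid
    N = m ℕ.+ suc n
    a = qexp m * qexp (suc n) + q ^ suc m * (qexp (suc m) * qexp n)

    shifted : gauss N (suc m) * qexp N ≈ qexp (suc m) * qexp n
    shifted rewrite ℕ.+-suc m n = gauss-qexp (suc m) n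

    lhs : gauss (suc N) (suc m) * qexp (suc N) ≈ a + q ^ suc N * (gauss (suc N) (suc m) * qexp (suc N))
    lhs = begin
      gauss (suc N) (suc m) * qexp (suc N)
        ≈⟨ *-congˡ (qexp-unfold N) ⟩
      gauss (suc N) (suc m) * (qexp N + q ^ suc N * qexp (suc N))
        ≈⟨ solve 6 (λ g p h e r f → (g :+ p :* h) :* (e :+ r :* f) := g :* e :+ p :* (h :* e) :+ r :* ((g :+ p :* h) :* f)) refl _ _ _ _ _ _ ⟩
      gauss N m * qexp N + q ^ suc m * (gauss N (suc m) * qexp N) + q ^ suc N * (gauss (suc N) (suc m) * qexp (suc N))
        ≈⟨ +-congʳ (+-cong (gauss-qexp m (suc n)) (*-congˡ shifted)) ⟩
      a + q ^ suc N * (gauss (suc N) (suc m) * qexp (suc N)) ∎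

    rhs : qexp (suc m) * qexp (suc n) ≈ a + q ^ suc N * (qexp (suc m) * qexp (suc n))
    rhs = begin
      qexp (suc m) * qexp (suc n)
        ≈⟨ *-congʳ (qexp-unfold m) ⟩
      (qexp m + q ^ suc m * qexp (suc m)) * qexp (suc n)
        ≈⟨ distribʳ _ _ _ ⟩
      qexp m * qexp (suc n) + q ^ suc m * qexp (suc m) * qexp (suc n)
        ≈⟨ +-congˡ (*-congˡ (qexp-unfold n)) ⟩
      qexp m * qexp (suc n) + q ^ suc m * qexp (suc m) * (qexp n + q ^ suc n * qexp (suc n))
        ≈⟨ solve 6 (λ x p y e r f → x :+ p :* y :* (e :+ r :* f) := x :+ p :* (y :* e) :+ (p :* r) :* (y :* f)) refl _ _ _ _ _ (qexp (suc n)) ⟩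
      a + (q ^ suc m * q ^ suc n) * (qexp (suc m) * qexp (suc n))
        ≈⟨ +-congˡ (*-congʳ (^-homo-* q (suc m) (suc n))) ⟨
      a + q ^ suc N * (qexp (suc m) * qexp (suc n)) ∎

-- Permutations with prescribed descents, counted by first letter, and their generating function.

module Boustrophedon {c ℓ} (Q : QRing c ℓ) (k : ℕ) where

  open QRing Q
  open PowerSeries R
  open Decimation R k
  open QExponential Q

  open Exp semiring using (^-homo-*)
  open Solver commutativeSemiring using (solve; _:=_; _:+_; _:*_; con)
  open SetoidReasoning setoid

  sumFrom : ℕ → ℕ → (ℕ → Carrier) → Carrier
  sumFrom s zero    f = 0#
  sumFrom s (suc n) f = f s + sumFrom (suc s) n f

  sumFrom-cong : ∀ s n {f g} → (∀ b → s ℕ.≤ b → b ℕ.< s ℕ.+ n → f b ≈ g b) → sumFrom s n f ≈ sumFrom s n g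
  sumFrom-cong s zero    f≈g = refl
  sumFrom-cong s (suc n) f≈g = +-cong
    (f≈g s ℕ.≤-refl (ℕ.m<m+n s ℕ.z<s))
    (sumFrom-cong (suc s) n λ b s<b b< → f≈g b (ℕ.<⇒≤ s<b) (≡.subst (b ℕ.<_) (≡.sym (ℕ.+-suc s n)) b<))

  sumFrom-++ : ∀ s m n f → sumFrom s (m ℕ.+ n) f ≈ sumFrom s m f + sumFrom (s ℕ.+ m) n f
  sumFrom-++ s zero    n f rewrite ℕ.+-identityʳ s = sym (+-identityˡ _)
  sumFrom-++ s (suc m) n f rewrite ℕ.+-suc s m     = trans (+-congˡ (sumFrom-++ (suc s) m n f)) (sym (+-assoc _ _ _))

  sumFrom-⊕ : ∀ s n f g → sumFrom s n (f ⊕ g) ≈ sumFrom s n f + sumFrom s n g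
  sumFrom-⊕ s zero    f g = sym (+-identityˡ _)
  sumFrom-⊕ s (suc n) f g = trans (+-congˡ (sumFrom-⊕ (suc s) n f g))
    (solve 4 (λ a b x y → a :+ b :+ (x :+ y) := a :+ x :+ (b :+ y)) refl _ _ _ _)

  sumFrom-scale : ∀ s n a f → sumFrom s n (λ b → a * f b) ≈ a * sumFrom s n f
  sumFrom-scale s zero    a f = sym (zeroʳ _)
  sumFrom-scale s (suc n) a f = trans (+-congˡ (sumFrom-scale (suc s) n a f)) (sym (distribˡ _ _ _))

  -- A function f stands for a weighting of the standardised words of length n by their
  -- first letter a < n; each operation prepends a letter a, which contributes a inversions.
  ascend descend prepend : ℕ → Series → Series
  ascend  n f a = q ^ a * sumFrom a (n ℕ.∸ a) f
  descend n f a = q ^ a * sumFrom 0 a f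
  prepend n f a = q ^ a * sumFrom 0 n f

  climb : ℕ → ℕ → Series → Series
  climb zero    n f = f
  climb (suc m) n f = climb m (suc n) (ascend n f)

  -- kWords j l weights the words of length suc l whose first letter sits at position j.
  kWords : ℕ → ℕ → Series
  kWords j zero    a = q ^ a
  kWords j (suc l) = if ⌊ k ∣? j ⌋ then descend (suc l) (kWords (suc j) l) else ascend (suc l) (kWords (suc j) l)

  ascend-cong : ∀ n {f g} → (∀ b → b ℕ.< n → f b ≈ g b) → ascend n f ≋ ascend n g
  ascend-cong n f≈g a with ℕ.≤-total a n
  ... | inj₁ a≤n = *-congˡ (sumFrom-cong a (n ℕ.∸ a) λ b _ b< → f≈g b (≡.subst (b ℕ.<_) (ℕ.m+[n∸m]≡n a≤n) b<))
  ... | inj₂ n≤a rewrite ℕ.m≤n⇒m∸n≡0 n≤a = refl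

  -- A prepended letter is followed by either a smaller or a larger one, so together the two cases
  -- leave the position unconstrained. Inclusion-exclusion rests on this.
  descend⊕ascend : ∀ n f a → a ℕ.≤ n → (descend n f ⊕ ascend n f) a ≈ prepend n f a
  descend⊕ascend n f a a≤n = begin
    q ^ a * sumFrom 0 a f + q ^ a * sumFrom a (n ℕ.∸ a) f  ≈⟨ distribˡ _ _ _ ⟨
    q ^ a * (sumFrom 0 a f + sumFrom a (n ℕ.∸ a) f)        ≈⟨ *-congˡ (sumFrom-++ 0 a (n ℕ.∸ a) f) ⟨
    q ^ a * sumFrom 0 (a ℕ.+ (n ℕ.∸ a)) f                  ≡⟨ ≡.cong (λ m → q ^ a * sumFrom 0 m f) (ℕ.m+[n∸m]≡n a≤n) ⟩
    q ^ a * sumFrom 0 n f                                  ∎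

  climb-cong : ∀ m n {f g} → (∀ b → b ℕ.< n → f b ≈ g b) → ∀ a → a ℕ.< m ℕ.+ n → climb m n f a ≈ climb m n g a
  climb-cong zero    n f≈g a a< = f≈g a a<
  climb-cong (suc m) n f≈g a a< = climb-cong m (suc n) (λ b _ → ascend-cong n f≈g b) a (≡.subst (a ℕ.<_) (≡.sym (ℕ.+-suc m n)) a<)

  climb-⊕ : ∀ m n f g → ∀ a → a ℕ.< m ℕ.+ n → climb m n (f ⊕ g) a ≈ climb m n f a + climb m n g a
  climb-⊕ zero    n f g a a< = refl
  climb-⊕ (suc m) n f g a a< = trans
    (climb-cong m (suc n) (λ b _ → trans (*-congˡ (sumFrom-⊕ b (n ℕ.∸ b) f g)) (distribˡ _ _ _)) a a<′)
    (climb-⊕ m (suc n) (ascend n f) (ascend n g) a a<′)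
    where a<′ = ≡.subst (a ℕ.<_) (≡.sym (ℕ.+-suc m n)) a<

  -- Words of length suc n whose first suc m letters increase, all other choices contributing T.
  cell : ℕ → ℕ → Carrier → Series
  cell m n T a = q ^ (suc m ℕ.* a) * gauss (n ℕ.∸ a) m * T

  -- Induction on c: the term at a and the sum from `suc a` on are the two summands of the q-Pascal
  -- rule.
  sum-cell : ∀ m n T f → (∀ b → b ℕ.≤ n → f b ≈ cell m n T b) → ∀ a c → a ℕ.+ c ≡ suc n →
    sumFrom a c f ≈ q ^ (suc m ℕ.* a) * gauss c (suc m) * T
  sum-cell m n T f f≈ a zero    _  = sym (trans (*-congʳ (zeroʳ _)) (zeroˡ _))
  sum-cell m n T f f≈ a (suc c) eq = begin
    f a + sumFrom (suc a) c f
      ≈⟨ +-cong (f≈ a (≡.subst (a ℕ.≤_) a+c≡n (ℕ.m≤m+n a c))) (sum-cell m n T f f≈ (suc a) c (≡.cong suc a+c≡n)) ⟩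
    q ^ (suc m ℕ.* a) * gauss (n ℕ.∸ a) m * T + q ^ (suc m ℕ.* suc a) * gauss c (suc m) * T
      ≡⟨ ≡.cong₂ (λ x y → q ^ (suc m ℕ.* a) * gauss x m * T + q ^ y * gauss c (suc m) * T)
           (≡.trans (≡.cong (ℕ._∸ a) (≡.sym a+c≡n)) (ℕ.m+n∸m≡n a c)) (ℕ.*-suc (suc m) a) ⟩
    q ^ (suc m ℕ.* a) * gauss c m * T + q ^ (suc m ℕ.+ suc m ℕ.* a) * gauss c (suc m) * T
      ≈⟨ +-congˡ (*-congʳ (*-congʳ (^-homo-* q (suc m) (suc m ℕ.* a)))) ⟩
    q ^ (suc m ℕ.* a) * gauss c m * T + q ^ suc m * q ^ (suc m ℕ.* a) * gauss c (suc m) * T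
      ≈⟨ solve 5 (λ p x T r y → p :* x :* T :+ r :* p :* y :* T := p :* (x :+ r :* y) :* T) refl _ _ _ (q ^ suc m) _ ⟩
    q ^ (suc m ℕ.* a) * gauss (suc c) (suc m) * T ∎
    where
    a+c≡n : a ℕ.+ c ≡ n
    a+c≡n = ℕ.suc-injective (≡.trans (≡.sym (ℕ.+-suc a c)) eq)

  -- The shape `cell` is stable: one ascent sums a cell by `sum-cell`, and its factor q^b raises the
  -- exponent from (m+1) b to (m+2) b.
  climb-cell : ∀ r m n T f → (∀ b → b ℕ.≤ n → f b ≈ cell m n T b) → ∀ a → a ℕ.≤ r ℕ.+ n →
    climb r (suc n) f a ≈ cell (m ℕ.+ r) (r ℕ.+ n) T a
  climb-cell zero    m n T f f≈ a a≤ rewrite ℕ.+-identityʳ m = f≈ a a≤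
  climb-cell (suc r) m n T f f≈ a a≤ rewrite ℕ.+-suc m r | ≡.sym (ℕ.+-suc r n) =
    climb-cell r (suc m) (suc n) T (ascend (suc n) f) step a a≤
    where
    step : ∀ b → b ℕ.≤ suc n → ascend (suc n) f b ≈ cell (suc m) (suc n) T b
    step b b≤ = begin
      q ^ b * sumFrom b (suc n ℕ.∸ b) f
        ≈⟨ *-congˡ (sum-cell m n T f f≈ b (suc n ℕ.∸ b) (ℕ.m+[n∸m]≡n b≤)) ⟩
      q ^ b * (q ^ (suc m ℕ.* b) * gauss (suc n ℕ.∸ b) (suc m) * T)
        ≈⟨ solve 4 (λ p r g T → p :* (r :* g :* T) := p :* r :* g :* T) refl _ _ _ _ ⟩
      q ^ b * q ^ (suc m ℕ.* b) * gauss (suc n ℕ.∸ b) (suc m) * T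
        ≈⟨ *-congʳ (*-congʳ (^-homo-* q b (suc m ℕ.* b))) ⟨
      cell (suc m) (suc n) T b ∎

  -- The r + 1 increasing letters are determined by their set, and the Gaussian binomial counts
  -- these sets by the inversions with the remaining letters.
  sum-climb : ∀ r n T f → (∀ b → b ℕ.≤ n → f b ≈ q ^ b * T) →
    sumFrom 0 (r ℕ.+ suc n) (climb r (suc n) f) ≈ gauss (r ℕ.+ suc n) (suc r) * T
  sum-climb r n T f f≈ = begin
    sumFrom 0 (r ℕ.+ suc n) (climb r (suc n) f)
      ≈⟨ sum-cell r (r ℕ.+ n) T (climb r (suc n) f) (climb-cell r 0 n T f f≈cell) 0 (r ℕ.+ suc n) (ℕ.+-suc r n) ⟩
    q ^ (suc r ℕ.* 0) * gauss (r ℕ.+ suc n) (suc r) * T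
      ≡⟨ ≡.cong (λ x → q ^ x * gauss (r ℕ.+ suc n) (suc r) * T) (ℕ.*-zeroʳ (suc r)) ⟩
    1# * gauss (r ℕ.+ suc n) (suc r) * T
      ≈⟨ *-congʳ (*-identityˡ _) ⟩
    gauss (r ℕ.+ suc n) (suc r) * T ∎
    where
    f≈cell : ∀ b → b ℕ.≤ n → f b ≈ cell 0 n T b
    f≈cell b b≤n rewrite ℕ.+-identityʳ b = trans (f≈ b b≤n) (*-congʳ (sym (*-identityʳ _)))

  kWords-periodic : ∀ j i l → k ∣ j → kWords (j ℕ.+ i) l ≋ kWords i l
  kWords-periodic j i zero    k∣j a = refl
  kWords-periodic j i (suc l) k∣j a with k ∣? j ℕ.+ i | k ∣? i
  ... | yes p  | no  ¬p = ⊥-elim (¬p (∣m+n∣m⇒∣n p k∣j))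
  ... | no  ¬p | yes p  = ⊥-elim (¬p (∣m∣n⇒∣m+n k∣j p))
  ... | yes _  | yes _  rewrite ≡.sym (ℕ.+-suc j i) = *-congˡ (sumFrom-cong 0 a λ b _ _ → kWords-periodic j (suc i) l k∣j b)
  ... | no  _  | no  _  rewrite ≡.sym (ℕ.+-suc j i) = ascend-cong (suc l) (λ b _ → kWords-periodic j (suc i) l k∣j b) a

  -- The value at 0 is a default: at multiples of k, `ratio` takes its coefficients from the series
  -- 1.
  euler : ℕ → Carrier
  euler zero    = 0#
  euler (suc l) = sumFrom 0 (suc l) (kWords 1 l)

  -- Words of length m + suc l that increase up to position suc m and follow the
  -- prescribed descents from there on; inclusion–exclusion runs along m.
  run : ℕ → ℕ → Carrier
  run m l = sumFrom 0 (m ℕ.+ suc l) (climb m (suc l) (kWords (suc m) l))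

  run-end : ∀ m → run m 0 ≈ 1#
  run-end m = begin
    run m 0                         ≈⟨ sum-climb m 0 1# (kWords (suc m) 0) (λ b _ → sym (*-identityʳ _)) ⟩
    gauss (m ℕ.+ 1) (suc m) * 1#    ≈⟨ *-identityʳ _ ⟩
    gauss (m ℕ.+ 1) (suc m)         ≡⟨ ≡.cong (λ x → gauss x (suc m)) (ℕ.+-comm m 1) ⟩
    gauss (suc m) (suc m)           ≈⟨ gauss-diagonal (suc m) ⟩
    1#                              ∎

  run-ascent : ∀ m l → ¬ k ∣ suc m → run m (suc l) ≈ run (suc m) l
  run-ascent m l k∤ with k ∣? suc m
  ... | yes k∣ = ⊥-elim (k∤ k∣)
  ... | no  _  rewrite ℕ.+-suc m (suc l) = refl

  -- Adding the two cases at position m + 1 frees that position. The word then splits into an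
  -- increasing block of m + 1 letters and a remainder starting at position m + 2, which is 1 modulo
  -- k, so its descent pattern is that of `euler`.
  run-descent : ∀ m l → k ∣ suc m →
    run m (suc l) + run (suc m) l ≈ gauss (suc m ℕ.+ suc l) (suc m) * euler (suc l)
  run-descent m l k∣ with k ∣? suc m
  ... | no  k∤ = ⊥-elim (k∤ k∣)
  ... | yes _  = begin
    sumFrom 0 N (climb m (suc n) (descend n f)) + sumFrom 0 (suc m ℕ.+ n) (climb m (suc n) (ascend n f))
      ≡⟨ ≡.cong (λ x → sumFrom 0 N (climb m (suc n) (descend n f)) + sumFrom 0 x (climb m (suc n) (ascend n f))) (ℕ.+-suc m n) ⟨
    sumFrom 0 N (climb m (suc n) (descend n f)) + sumFrom 0 N (climb m (suc n) (ascend n f))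
      ≈⟨ sumFrom-⊕ 0 N _ _ ⟨
    sumFrom 0 N (climb m (suc n) (descend n f) ⊕ climb m (suc n) (ascend n f))
      ≈⟨ sumFrom-cong 0 N (λ b _ b< → sym (climb-⊕ m (suc n) (descend n f) (ascend n f) b b<)) ⟩
    sumFrom 0 N (climb m (suc n) (descend n f ⊕ ascend n f))
      ≈⟨ sum-climb m n (sumFrom 0 n f) (descend n f ⊕ ascend n f) (descend⊕ascend n f) ⟩
    gauss N (suc m) * sumFrom 0 n f
      ≈⟨ *-congˡ (sumFrom-cong 0 n λ b _ _ → periodic b) ⟩
    gauss N (suc m) * euler n
      ≡⟨ ≡.cong (λ x → gauss x (suc m) * euler n) (ℕ.+-suc m n) ⟩
    gauss (suc m ℕ.+ n) (suc m) * euler n ∎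
    where
    n = suc l
    N = m ℕ.+ suc n
    f = kWords (suc (suc m)) l
    periodic : f ≋ kWords 1 l
    periodic = ≡.subst (λ x → kWords x l ≋ kWords 1 l) (ℕ.+-comm (suc m) 1) (kWords-periodic (suc m) 1 l k∣)

  -- (-1) to the number of multiples of k among 1, ..., n, that is, to the number of descents
  -- allowed up to n.
  sign : ℕ → Carrier
  sign zero    = 1#
  sign (suc n) = if ⌊ k ∣? suc n ⌋ then - sign n else sign n

  open RingProperties ring using (-‿distribˡ-*; -‿distribʳ-*; -‿involutive)

  sign² : ∀ n → sign n * sign n ≈ 1#
  sign² zero    = *-identityˡ _
  sign² (suc n) with k ∣? suc n
  ... | no  _ = sign² n
  ... | yes _ = begin
    - sign n * - sign n    ≈⟨ -‿distribˡ-* _ _ ⟨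
    - (sign n * - sign n)  ≈⟨ -‿cong (sym (-‿distribʳ-* _ _)) ⟩
    - - (sign n * sign n)  ≈⟨ -‿involutive _ ⟩
    sign n * sign n        ≈⟨ sign² n ⟩
    1#                     ∎

  sign-+ : ∀ m n → k ∣ m → sign (m ℕ.+ n) ≈ sign m * sign n
  sign-+ m zero    k∣m rewrite ℕ.+-identityʳ m = sym (*-identityʳ _)
  sign-+ m (suc n) k∣m rewrite ℕ.+-suc m n with k ∣? suc (m ℕ.+ n) | k ∣? suc n
  ... | no  _  | no  _  = sign-+ m n k∣m
  ... | yes _  | yes _  = trans (-‿cong (sign-+ m n k∣m)) (-‿distribʳ-* _ _)
  ... | yes p  | no  ¬p = ⊥-elim (¬p (∣m+n∣m⇒∣n (≡.subst (k ∣_) (≡.sym (ℕ.+-suc m n)) p) k∣m))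
  ... | no  ¬p | yes p  = ⊥-elim (¬p (≡.subst (k ∣_) (ℕ.+-suc m n) (∣m∣n⇒∣m+n k∣m p)))

  sign-ascent : ∀ m → ¬ k ∣ suc m → sign (suc m) ≡ sign m
  sign-ascent m k∤ with k ∣? suc m
  ... | yes k∣ = ⊥-elim (k∤ k∣)
  ... | no  _  = ≡.refl

  sign-descent : ∀ m → k ∣ suc m → sign (suc m) ≡ - sign m
  sign-descent m k∣ with k ∣? suc m
  ... | yes _  = ≡.refl
  ... | no  k∤ = ⊥-elim (k∤ k∣)

  -- The signed exponential generating function of the q-Euler numbers, with the terms of index
  -- divisible by k replaced by those of the constant series 1.
  ratio : Series
  ratio n = if ⌊ k ∣? n ⌋ then constant 1# n else sign n * (euler n * qexp n)

  ratio-zero : ratio 0 ≡ 1#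
  ratio-zero with k ∣? 0
  ... | yes _  = ≡.refl
  ... | no  k∤ = ⊥-elim (k∤ (k ∣0))

  ratio-no : ∀ {n} → ¬ k ∣ n → ratio n ≡ sign n * (euler n * qexp n)
  ratio-no {n} k∤ with k ∣? n
  ... | yes k∣ = ⊥-elim (k∤ k∣)
  ... | no  _  = ≡.refl

  private B = multiples qexp

  -- The convolution holds the terms of B · ratio with B-index above m, and the signed `run m l`
  -- stands for those up to m. Induction raises m until only the increasing word is left; at m = 0
  -- the run is the Euler number itself.
  partial-sum : ∀ l m {N} → m ℕ.+ suc l ≡ N → ¬ k ∣ N →
    ((λ j → B (suc m ℕ.+ j)) ⊛ ratio) l + sign N * sign m * (run m l * qexp N) ≈ qexp N
  partial-sum zero m {N} N≡ k∤ with ≡.trans (ℕ.+-comm 1 m) N≡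
  ... | ≡.refl = begin
    B (suc m ℕ.+ 0) * ratio 0 + sign N * sign m * (run m 0 * qexp N)
      ≡⟨ ≡.cong (λ x → B (suc x) * ratio 0 + sign N * sign m * (run m 0 * qexp N)) (ℕ.+-identityʳ m) ⟩
    B N * ratio 0 + sign N * sign m * (run m 0 * qexp N)
      ≈⟨ +-cong (*-congʳ (reflexive (multiples-no qexp k∤))) (*-cong (*-congʳ (reflexive (sign-ascent m k∤))) (*-congʳ (run-end m))) ⟩
    0# * ratio 0 + sign m * sign m * (1# * qexp N)
      ≈⟨ +-congˡ (*-congʳ (sign² m)) ⟩
    0# * ratio 0 + 1# * (1# * qexp N)
      ≈⟨ solve 2 (λ x y → con 0 :* x :+ con 1 :* (con 1 :* y) := y) refl _ _ ⟩
    qexp N ∎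
  partial-sum (suc l) m N≡ k∤ with ≡.trans (≡.sym (ℕ.+-suc m (suc l))) N≡
  ... | ≡.refl = begin
    B (suc m ℕ.+ 0) * ratio (suc l) + ((λ j → B (suc (m ℕ.+ suc j))) ⊛ ratio) l + sign N * sign m * (run m (suc l) * qexp N)
      ≈⟨ +-congʳ (+-cong (*-congʳ (reflexive (≡.cong (B ∘ suc) (ℕ.+-identityʳ m))))
                         (⊛-cong {g = ratio} (λ j → reflexive (≡.cong (B ∘ suc) (ℕ.+-suc m j))) (λ _ → refl) l)) ⟩
    B (suc m) * ratio (suc l) + rest + sign N * sign m * (run m (suc l) * qexp N)
      ≈⟨ step (k ∣? suc m) ⟩
    rest + sign N * sign (suc m) * (run (suc m) l * qexp N)
      ≈⟨ partial-sum l (suc m) ≡.refl k∤ ⟩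
    qexp N ∎
    where
    N = suc m ℕ.+ suc l
    rest = ((λ j → B (suc (suc m) ℕ.+ j)) ⊛ ratio) l

    step : Dec (k ∣ suc m) → B (suc m) * ratio (suc l) + rest + sign N * sign m * (run m (suc l) * qexp N)
         ≈ rest + sign N * sign (suc m) * (run (suc m) l * qexp N)
    step (no k∤m) = +-cong
      (trans (+-congʳ (trans (*-congʳ (reflexive (multiples-no qexp k∤m))) (zeroˡ _))) (+-identityˡ _))
      (*-cong (*-congˡ (reflexive (≡.sym (sign-ascent m k∤m)))) (*-congʳ (run-ascent m l k∤m)))
    -- By `gauss-qexp` the split-off term becomes a multiple of the right side of `run-descent`,
    -- hence of a sum of two runs. The sign changes at `suc m`, so `run m (suc l)` cancels and
    -- `run (suc m) l` remains.
    step (yes k∣m) = begin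
      B (suc m) * ratio (suc l) + rest + sign N * sign m * (run m (suc l) * qexp N)
        ≈⟨ +-congʳ (+-congʳ (*-cong (reflexive (multiples-yes qexp k∣m)) (reflexive (ratio-no k∤l)))) ⟩
      qexp (suc m) * (sign (suc l) * (euler (suc l) * qexp (suc l))) + rest + sign N * sign m * (run m (suc l) * qexp N)
        ≈⟨ +-congʳ (+-congʳ (solve 4 (λ a s b c → a :* (s :* (b :* c)) := s :* (b :* (a :* c))) refl _ _ _ _)) ⟩
      sign (suc l) * (euler (suc l) * (qexp (suc m) * qexp (suc l))) + rest + sign N * sign m * (run m (suc l) * qexp N)
        ≈⟨ +-congʳ (+-congʳ (*-cong (sym same) (*-congˡ (sym (gauss-qexp (suc m) (suc l)))))) ⟩
      s * (euler (suc l) * (gauss N (suc m) * qexp N)) + rest + sign N * sign m * (run m (suc l) * qexp N)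
        ≈⟨ +-congʳ (+-congʳ (*-congˡ (trans (solve 3 (λ a b c → a :* (b :* c) := b :* a :* c) refl _ _ _) (*-congʳ (sym (run-descent m l k∣m)))))) ⟩
      s * ((run m (suc l) + run (suc m) l) * qexp N) + rest + sign N * sign m * (run m (suc l) * qexp N)
        ≈⟨ solve 6 (λ s a b e r t → s :* ((a :+ b) :* e) :+ r :+ t :* (a :* e) := (s :+ t) :* (a :* e) :+ (r :+ s :* (b :* e))) refl _ _ _ _ _ _ ⟩
      (s + sign N * sign m) * (run m (suc l) * qexp N) + (rest + s * (run (suc m) l * qexp N))
        ≈⟨ +-congʳ (trans (*-congʳ opposite) (zeroˡ _)) ⟩
      0# + (rest + s * (run (suc m) l * qexp N))
        ≈⟨ +-identityˡ _ ⟩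
      rest + s * (run (suc m) l * qexp N) ∎
      where
      s = sign N * sign (suc m)
      k∤l : ¬ k ∣ suc l
      k∤l k∣l = k∤ (∣m∣n⇒∣m+n k∣m k∣l)
      same : s ≈ sign (suc l)
      same = begin
        sign N * sign (suc m)                       ≈⟨ *-congʳ (sign-+ (suc m) (suc l) k∣m) ⟩
        sign (suc m) * sign (suc l) * sign (suc m)  ≈⟨ solve 2 (λ a b → a :* b :* a := a :* a :* b) refl _ _ ⟩
        sign (suc m) * sign (suc m) * sign (suc l)  ≈⟨ *-congʳ (sign² (suc m)) ⟩
        1# * sign (suc l)                           ≈⟨ *-identityˡ _ ⟩
        sign (suc l)                                ∎
      opposite : s + sign N * sign m ≈ 0#
      opposite = begin
        sign N * sign (suc m) + sign N * sign m  ≈⟨ distribˡ _ _ _ ⟨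
        sign N * (sign (suc m) + sign m)         ≈⟨ *-congˡ (+-congʳ (reflexive (sign-descent m k∣m))) ⟩
        sign N * (- sign m + sign m)             ≈⟨ *-congˡ (-‿inverseˡ _) ⟩
        sign N * 0#                              ≈⟨ zeroʳ _ ⟩
        0#                                       ∎

  -- At multiples of k, `multiples-⊛` leaves B times the decimated ratio, which is 1 by the
  -- convention in `ratio`. At other exponents this is `partial-sum` with m = 0.
  ratio⊛multiples : ratio ⊛ multiples qexp ≋ qexp
  ratio⊛multiples n = trans (⊛-comm ratio B n) (go n (k ∣? n))
    where
    multiples-ratio : multiples ratio ≋ constant 1#
    multiples-ratio n with k ∣? n
    ... | yes _  = refl
    multiples-ratio zero    | no k∤ = ⊥-elim (k∤ (k ∣0))
    multiples-ratio (suc n) | no _  = refl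

    go : ∀ n → Dec (k ∣ n) → (B ⊛ ratio) n ≈ qexp n
    go n (yes k∣n) = begin
      (B ⊛ ratio) n              ≡⟨ multiples-yes (B ⊛ ratio) k∣n ⟨
      multiples (B ⊛ ratio) n    ≈⟨ multiples-⊛ B ratio (λ m k∤m → reflexive (multiples-no qexp k∤m)) n ⟩
      (B ⊛ multiples ratio) n    ≈⟨ ⊛-cong {B} (λ _ → refl) multiples-ratio n ⟩
      (B ⊛ constant 1#) n        ≈⟨ S.*-identityʳ B n ⟩
      B n                        ≡⟨ multiples-yes qexp k∣n ⟩
      qexp n                     ∎
    go zero    (no k∤) = ⊥-elim (k∤ (k ∣0))
    go (suc l) (no k∤) = begin
      B 0 * ratio (suc l) + (tail B ⊛ ratio) l
        ≈⟨ +-congʳ (*-cong (reflexive (multiples-yes qexp (k ∣0))) (reflexive (ratio-no k∤))) ⟩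
      1# * (sign (suc l) * (euler (suc l) * qexp (suc l))) + (tail B ⊛ ratio) l
        ≈⟨ solve 3 (λ s x r → con 1 :* (s :* x) :+ r := r :+ s :* con 1 :* x) refl _ _ _ ⟩
      (tail B ⊛ ratio) l + sign (suc l) * 1# * (euler (suc l) * qexp (suc l))
        ≈⟨ partial-sum l 0 ≡.refl k∤ ⟩
      qexp (suc l) ∎

-- Standardisation of words and its effect on inversions and descents.

<ᵇ-true : ∀ {m n} → m ℕ.< n → (m <ᵇ n) ≡ true
<ᵇ-true {m} {n} = dec-true (m ℕ.<? n)

<ᵇ-false : ∀ {m n} → n ℕ.≤ m → (m <ᵇ n) ≡ false
<ᵇ-false {m} {n} n≤m = dec-false (m ℕ.<? n) (ℕ.≤⇒≯ n≤m)

≡ᵇ-false : ∀ {m n} → ¬ m ≡ n → (m ≡ᵇ n) ≡ false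
≡ᵇ-false {m} {n} = dec-false (m ℕ.≟ n)

-- The increasing bijection from ℕ onto the complement of a. It undoes standardisation after a first
-- letter a has been removed.
skip : ℕ → ℕ → ℕ
skip a x = if x <ᵇ a then x else suc x

skip-< : ∀ {a x} → x ℕ.< a → skip a x ≡ x
skip-< x<a rewrite <ᵇ-true x<a = ≡.refl

skip-≥ : ∀ {a x} → a ℕ.≤ x → skip a x ≡ suc x
skip-≥ a≤x rewrite <ᵇ-false a≤x = ≡.refl

skip-<ᵇ : ∀ a x y → (skip a x <ᵇ skip a y) ≡ (x <ᵇ y)
skip-<ᵇ a x y with ℕ.<-≤-connex x a | ℕ.<-≤-connex y a
... | inj₁ x<a | inj₁ y<a rewrite skip-< x<a | skip-< y<a = ≡.refl
... | inj₂ a≤x | inj₂ a≤y rewrite skip-≥ a≤x | skip-≥ a≤y = ≡.refl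
... | inj₁ x<a | inj₂ a≤y rewrite skip-< x<a | skip-≥ a≤y | <ᵇ-true (ℕ.<-≤-trans x<a a≤y) =
  <ᵇ-true (ℕ.m<n⇒m<1+n (ℕ.<-≤-trans x<a a≤y))
... | inj₂ a≤x | inj₁ y<a rewrite skip-≥ a≤x | skip-< y<a | <ᵇ-false (ℕ.<⇒≤ (ℕ.<-≤-trans y<a a≤x)) =
  <ᵇ-false (ℕ.m≤n⇒m≤1+n (ℕ.<⇒≤ (ℕ.<-≤-trans y<a a≤x)))

skip-≡ᵇ : ∀ a x y → (skip a x ≡ᵇ skip a y) ≡ (x ≡ᵇ y)
skip-≡ᵇ a x y with ℕ.<-≤-connex x a | ℕ.<-≤-connex y a
... | inj₁ x<a | inj₁ y<a rewrite skip-< x<a | skip-< y<a = ≡.refl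
... | inj₂ a≤x | inj₂ a≤y rewrite skip-≥ a≤x | skip-≥ a≤y = ≡.refl
... | inj₁ x<a | inj₂ a≤y rewrite skip-< x<a | skip-≥ a≤y | ≡ᵇ-false (ℕ.<⇒≢ (ℕ.<-≤-trans x<a a≤y)) =
  ≡ᵇ-false (ℕ.<⇒≢ (ℕ.m<n⇒m<1+n (ℕ.<-≤-trans x<a a≤y)))
... | inj₂ a≤x | inj₁ y<a rewrite skip-≥ a≤x | skip-< y<a | ≡ᵇ-false (ℕ.>⇒≢ (ℕ.<-≤-trans y<a a≤x)) =
  ≡ᵇ-false (ℕ.>⇒≢ (ℕ.m<n⇒m<1+n (ℕ.<-≤-trans y<a a≤x)))

skip-<ᵇ-≤ : ∀ {a b} x → a ℕ.≤ b → (skip b x <ᵇ a) ≡ (x <ᵇ a)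
skip-<ᵇ-≤ {a} {b} x a≤b with ℕ.<-≤-connex x b
... | inj₁ x<b rewrite skip-< x<b = ≡.refl
... | inj₂ b≤x rewrite skip-≥ b≤x | <ᵇ-false (ℕ.≤-trans a≤b b≤x) = <ᵇ-false (ℕ.m≤n⇒m≤1+n (ℕ.≤-trans a≤b b≤x))

skip-<ᵇ-> : ∀ {a b} x → b ℕ.≤ a → (skip b x <ᵇ suc a) ≡ (x <ᵇ a)
skip-<ᵇ-> {a} {b} x b≤a with ℕ.<-≤-connex x b
... | inj₁ x<b rewrite skip-< x<b | <ᵇ-true (ℕ.<-≤-trans x<b b≤a) = <ᵇ-true (ℕ.m<n⇒m<1+n (ℕ.<-≤-trans x<b b≤a))
... | inj₂ b≤x rewrite skip-≥ b≤x = ≡.refl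

notIn-skip : ∀ a x w → notIn (skip a x) (map (skip a) w) ≡ notIn x w
notIn-skip a x []      = ≡.refl
notIn-skip a x (y ∷ w) = ≡.cong₂ (λ b → not b ∧_) (skip-≡ᵇ a x y) (notIn-skip a x w)

distinct-skip : ∀ a w → distinct (map (skip a) w) ≡ distinct w
distinct-skip a []      = ≡.refl
distinct-skip a (x ∷ w) = ≡.cong₂ _∧_ (notIn-skip a x w) (distinct-skip a w)

countLess-map : ∀ a a′ f w → (∀ x → (f x <ᵇ a) ≡ (x <ᵇ a′)) → countLess a (map f w) ≡ countLess a′ w
countLess-map a a′ f []      eq = ≡.refl
countLess-map a a′ f (x ∷ w) eq = ≡.cong₂ (λ b → (if b then 1 else 0) ℕ.+_) (eq x) (countLess-map a a′ f w eq)

inv-skip : ∀ a w → inv (map (skip a) w) ≡ inv w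
inv-skip a []      = ≡.refl
inv-skip a (x ∷ w) = ≡.cong₂ ℕ._+_ (countLess-map (skip a x) x (skip a) w (λ y → skip-<ᵇ a y x)) (inv-skip a w)

desCheck-skip : ∀ k j a w → desCheck k j (map (skip a) w) ≡ desCheck k j w
desCheck-skip k j a []          = ≡.refl
desCheck-skip k j a (x ∷ [])    = ≡.refl
desCheck-skip k j a (x ∷ y ∷ w) =
  ≡.cong₂ (λ b → (b xor not ⌊ k ∣? j ⌋) ∧_) (skip-<ᵇ a y x) (desCheck-skip k (suc j) a (y ∷ w))

data Standard : ℕ → List ℕ → Set where
  []  : Standard 0 []
  _∷_ : ∀ {n a w} → a ℕ.≤ n → Standard n w → Standard (suc n) (suc a ∷ map (skip (suc a)) w)

-- A permutation contains each of 1, ..., a once. Removing the first letter `suc b` keeps the bound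
-- if a ≤ b; if b < a, that letter is counted and the bound drops by one.
countLess-standard : ∀ {n w} → Standard n w → ∀ {a} → a ℕ.≤ n → countLess (suc a) w ≡ a
countLess-standard []                         ℕ.z≤n = ≡.refl
countLess-standard (_∷_ {n} {b} {w} b≤n std) {a} a≤n with ℕ.<-≤-connex b a
... | inj₂ a≤b rewrite <ᵇ-false a≤b =
  ≡.trans (countLess-map (suc a) (suc a) (skip (suc b)) w (λ x → skip-<ᵇ-≤ x (ℕ.s≤s a≤b)))
          (countLess-standard std (ℕ.≤-trans a≤b b≤n))
countLess-standard (_∷_ {n} {b} {w} b≤n std) {suc a} (ℕ.s≤s a≤n) | inj₁ b<a rewrite <ᵇ-true b<a =
  ≡.cong suc (≡.trans (countLess-map (suc (suc a)) (suc a) (skip (suc b)) w (λ x → skip-<ᵇ-> x b<a))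
                      (countLess-standard std a≤n))

-- The recursive count agrees with the sum over the list of permutations.

module Words {c ℓ} (Q : QRing c ℓ) (k : ℕ) where

  open QRing Q
  open Boustrophedon Q k

  open Exp semiring using (^-homo-*)
  open SetoidReasoning setoid

  sumList : {A : Set} → List A → (A → Carrier) → Carrier
  sumList xs f = foldr (λ x acc → f x + acc) 0# xs

  sumList-cong : ∀ {A : Set} (xs : List A) {f g} → (∀ x → f x ≈ g x) → sumList xs f ≈ sumList xs g
  sumList-cong []       f≈g = refl
  sumList-cong (x ∷ xs) f≈g = +-cong (f≈g x) (sumList-cong xs f≈g)

  sumList-++ : ∀ {A : Set} (xs ys : List A) f → sumList (xs ++ ys) f ≈ sumList xs f + sumList ys f
  sumList-++ []       ys f = sym (+-identityˡ _)
  sumList-++ (x ∷ xs) ys f = trans (+-congˡ (sumList-++ xs ys f)) (sym (+-assoc _ _ _))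

  sumList-map : ∀ {A B : Set} (g : A → B) xs f → sumList (map g xs) f ≡ sumList xs (f ∘ g)
  sumList-map g []       f = ≡.refl
  sumList-map g (x ∷ xs) f = ≡.cong (f (g x) +_) (sumList-map g xs f)

  sumList-concatMap : ∀ {A B : Set} (g : A → List B) xs f → sumList (concatMap g xs) f ≈ sumList xs (λ x → sumList (g x) f)
  sumList-concatMap g []       f = refl
  sumList-concatMap g (x ∷ xs) f = trans (sumList-++ (g x) _ f) (+-congˡ (sumList-concatMap g xs f))

  sumList-zero : ∀ {A : Set} (xs : List A) → sumList xs (λ _ → 0#) ≈ 0#
  sumList-zero []       = refl
  sumList-zero (x ∷ xs) = trans (+-identityˡ _) (sumList-zero xs)

  sumList-filter : ∀ {A : Set} (p : A → Bool) xs f →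
    sumList (filter (λ x → Data.Bool._≟_ (p x) true) xs) f ≈ sumList xs (λ x → if p x then f x else 0#)
  sumList-filter p []       f = refl
  sumList-filter p (x ∷ xs) f with p x
  ... | true  = +-congˡ (sumList-filter p xs f)
  ... | false = trans (sumList-filter p xs f) (sym (+-identityˡ _))

  sumList-letters : ∀ n f → sumList (map suc (upTo n)) f ≈ sumFrom 1 n f
  sumList-letters n f = go n id 1 (λ _ → ≡.refl)
    where
    go : ∀ n g s → (∀ i → suc (g i) ≡ s ℕ.+ i) → sumList (map suc (applyUpTo g n)) f ≈ sumFrom s n f
    go zero    g s eq = refl
    go (suc n) g s eq = +-cong (reflexive (≡.cong f (≡.trans (eq 0) (ℕ.+-identityʳ s))))
      (go n (g ∘ suc) (suc s) (λ i → ≡.trans (eq (suc i)) (ℕ.+-suc s i)))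

  sumFrom-suc : ∀ s n f → sumFrom (suc s) n f ≡ sumFrom s n (f ∘ suc)
  sumFrom-suc s zero    f = ≡.refl
  sumFrom-suc s (suc n) f = ≡.cong (f (suc s) +_) (sumFrom-suc (suc s) n f)

  sumFrom-zero : ∀ s n f → (∀ b → s ℕ.≤ b → b ℕ.< s ℕ.+ n → f b ≈ 0#) → sumFrom s n f ≈ 0#
  sumFrom-zero s zero    f f≈0 = refl
  sumFrom-zero s (suc n) f f≈0 = trans (+-cong
    (f≈0 s ℕ.≤-refl (ℕ.m<m+n s ℕ.z<s))
    (sumFrom-zero (suc s) n f (λ b s<b b< → f≈0 b (ℕ.<⇒≤ s<b) (≡.subst (b ℕ.<_) (≡.sym (ℕ.+-suc s n)) b<))))
    (+-identityˡ _)

  if-cong : ∀ b {x y} → x ≈ y → (if b then x else 0#) ≈ (if b then y else 0#)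
  if-cong true  x≈y = x≈y
  if-cong false x≈y = refl

  sumFrom-≢ : ∀ s n {a} f → s ℕ.≤ a → a ℕ.≤ s ℕ.+ n →
    sumFrom s (suc n) (λ b → if not (a ≡ᵇ b) then f b else 0#) ≈ sumFrom s n (f ∘ skip a)
  sumFrom-≢ s n {a} f s≤a a≤ with ℕ.m≤n⇒m<n∨m≡n s≤a
  ... | inj₂ ≡.refl = begin
    g s + sumFrom (suc s) n g     ≈⟨ +-congʳ (reflexive (≡.cong (λ b → if not b then f s else 0#) (dec-true (s ℕ.≟ s) ≡.refl))) ⟩
    0# + sumFrom (suc s) n g      ≈⟨ +-identityˡ _ ⟩
    sumFrom (suc s) n g           ≡⟨ sumFrom-suc s n g ⟩
    sumFrom s n (g ∘ suc)         ≈⟨ sumFrom-cong s n (λ b s≤b _ → reflexive (≡.trans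
                                       (≡.cong (λ x → if not x then f (suc b) else 0#) (≡ᵇ-false (ℕ.<⇒≢ (ℕ.s≤s s≤b))))
                                       (≡.cong f (≡.sym (skip-≥ s≤b))))) ⟩
    sumFrom s n (f ∘ skip a)      ∎
    where
    g : ℕ → Carrier
    g b = if not (s ≡ᵇ b) then f b else 0#
  sumFrom-≢ s zero    f s≤a a≤ | inj₁ s<a = ⊥-elim (ℕ.<⇒≱ s<a (≡.subst (_ ℕ.≤_) (ℕ.+-identityʳ s) a≤))
  sumFrom-≢ s (suc n) {a} f s≤a a≤ | inj₁ s<a rewrite ≡ᵇ-false {a} (ℕ.>⇒≢ s<a) | skip-< s<a =
    +-congˡ (sumFrom-≢ (suc s) n f s<a (≡.subst (a ℕ.≤_) (ℕ.+-suc s n) a≤))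

  sum-words : ∀ N n f → sumList (words N (suc n)) f ≈ sumFrom 1 N (λ a → sumList (words N n) (f ∘ (a ∷_)))
  sum-words N n f = begin
    sumList (words N (suc n)) f                                               ≈⟨ sumList-concatMap (λ a → map (a ∷_) (words N n)) (map suc (upTo N)) f ⟩
    sumList (map suc (upTo N)) (λ a → sumList (map (a ∷_) (words N n)) f)     ≈⟨ sumList-cong (map suc (upTo N)) (λ a → reflexive (sumList-map (a ∷_) (words N n) f)) ⟩
    sumList (map suc (upTo N)) (λ a → sumList (words N n) (f ∘ (a ∷_)))       ≈⟨ sumList-letters N _ ⟩
    sumFrom 1 N (λ a → sumList (words N n) (f ∘ (a ∷_)))                      ∎

  -- `skip a` is a bijection from N letters to the N + 1 letters other than a; it is applied letter
  -- by letter.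
  sum-words-avoiding : ∀ N n {a} f → 1 ℕ.≤ a → a ℕ.≤ suc N →
    sumList (words (suc N) n) (λ w → if notIn a w then f w else 0#) ≈ sumList (words N n) (f ∘ map (skip a))
  sum-words-avoiding N zero        f 1≤a a≤ = refl
  sum-words-avoiding N (suc n) {a} f 1≤a a≤ = begin
    sumList (words (suc N) (suc n)) (λ w → if notIn a w then f w else 0#)
      ≈⟨ sum-words (suc N) n _ ⟩
    sumFrom 1 (suc N) (λ b → sumList (words (suc N) n) (λ w → if not (a ≡ᵇ b) ∧ notIn a w then f (b ∷ w) else 0#))
      ≈⟨ sumFrom-cong 1 (suc N) (λ b _ _ → pull (not (a ≡ᵇ b)) b) ⟩
    sumFrom 1 (suc N) (λ b → if not (a ≡ᵇ b) then sumList (words N n) (f ∘ (b ∷_) ∘ map (skip a)) else 0#)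
      ≈⟨ sumFrom-≢ 1 N _ 1≤a a≤ ⟩
    sumFrom 1 N (λ b → sumList (words N n) (f ∘ (skip a b ∷_) ∘ map (skip a)))
      ≈⟨ sum-words N n (f ∘ map (skip a)) ⟨
    sumList (words N (suc n)) (f ∘ map (skip a)) ∎
    where
    pull : ∀ p b → sumList (words (suc N) n) (λ w → if p ∧ notIn a w then f (b ∷ w) else 0#)
                 ≈ (if p then sumList (words N n) (f ∘ (b ∷_) ∘ map (skip a)) else 0#)
    pull true  b = sum-words-avoiding N n (f ∘ (b ∷_)) 1≤a a≤
    pull false b = sumList-zero (words (suc N) n)

  sumPerm : ℕ → (List ℕ → Carrier) → Carrier
  sumPerm zero    f = f []
  sumPerm (suc n) f = sumFrom 0 (suc n) (λ a → sumPerm n (λ w → f (suc a ∷ map (skip (suc a)) w)))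

  sumPerm-cong : ∀ n {f g} → (∀ w → Standard n w → f w ≈ g w) → sumPerm n f ≈ sumPerm n g
  sumPerm-cong zero    f≈g = f≈g [] []
  sumPerm-cong (suc n) f≈g = sumFrom-cong 0 (suc n) λ a _ a< → sumPerm-cong n λ w std → f≈g _ (ℕ.≤-pred a< ∷ std)

  sumPerm-scale : ∀ n a f → sumPerm n (λ w → a * f w) ≈ a * sumPerm n f
  sumPerm-scale zero    a f = refl
  sumPerm-scale (suc n) a f = trans (sumFrom-cong 0 (suc n) λ _ _ _ → sumPerm-scale n a _) (sumFrom-scale 0 (suc n) a _)

  sumPerm-zero : ∀ n → sumPerm n (λ _ → 0#) ≈ 0#
  sumPerm-zero zero    = refl
  sumPerm-zero (suc n) = sumFrom-zero 0 (suc n) _ λ _ _ _ → sumPerm-zero n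

  sum-distinct : ∀ n f → sumList (words n n) (λ w → if distinct w then f w else 0#) ≈ sumPerm n f
  sum-distinct zero    f = +-identityʳ _
  sum-distinct (suc n) f = begin
    sumList (words (suc n) (suc n)) (λ w → if distinct w then f w else 0#)
      ≈⟨ sum-words (suc n) n _ ⟩
    sumFrom 1 (suc n) (λ a → sumList (words (suc n) n) (λ w → if notIn a w ∧ distinct w then f (a ∷ w) else 0#))
      ≈⟨ sumFrom-cong 1 (suc n) step ⟩
    sumFrom 1 (suc n) (λ a → sumPerm n (λ w → f (a ∷ map (skip a) w)))
      ≡⟨ sumFrom-suc 0 (suc n) _ ⟩
    sumPerm (suc n) f ∎
    where
    nest : ∀ b b′ x → (if b ∧ b′ then x else 0#) ≡ (if b then if b′ then x else 0# else 0#)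
    nest true  b′ x = ≡.refl
    nest false b′ x = ≡.refl

    step : ∀ a → 1 ℕ.≤ a → a ℕ.< 1 ℕ.+ suc n →
      sumList (words (suc n) n) (λ w → if notIn a w ∧ distinct w then f (a ∷ w) else 0#) ≈
      sumPerm n (λ w → f (a ∷ map (skip a) w))
    step a 1≤a a< = begin
      sumList (words (suc n) n) (λ w → if notIn a w ∧ distinct w then f (a ∷ w) else 0#)
        ≈⟨ sumList-cong (words (suc n) n) (λ w → reflexive (nest (notIn a w) (distinct w) (f (a ∷ w)))) ⟩
      sumList (words (suc n) n) (λ w → if notIn a w then if distinct w then f (a ∷ w) else 0# else 0#)
        ≈⟨ sum-words-avoiding n n _ 1≤a (ℕ.≤-pred a<) ⟩
      sumList (words n n) (λ w → if distinct (map (skip a) w) then f (a ∷ map (skip a) w) else 0#)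
        ≈⟨ sumList-cong (words n n) (λ w → reflexive (≡.cong (λ b → if b then f (a ∷ map (skip a) w) else 0#) (distinct-skip a w))) ⟩
      sumList (words n n) (λ w → if distinct w then f (a ∷ map (skip a) w) else 0#)
        ≈⟨ sum-distinct n (λ w → f (a ∷ map (skip a) w)) ⟩
      sumPerm n (λ w → f (a ∷ map (skip a) w)) ∎

  sumFrom-split : ∀ {a n} f → a ℕ.≤ n → sumFrom 0 n f ≈ sumFrom 0 a f + sumFrom a (n ℕ.∸ a) f
  sumFrom-split {a} {n} f a≤n = ≡.subst (λ m → sumFrom 0 m f ≈ sumFrom 0 a f + sumFrom a (n ℕ.∸ a) f) (ℕ.m+[n∸m]≡n a≤n) (sumFrom-++ 0 a (n ℕ.∸ a) f)

  sumFrom-below : ∀ {a n} f → a ℕ.≤ n → sumFrom 0 n (λ b → if b <ᵇ a then f b else 0#) ≈ sumFrom 0 a f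
  sumFrom-below {a} {n} f a≤n = begin
    sumFrom 0 n g                           ≈⟨ sumFrom-split g a≤n ⟩
    sumFrom 0 a g + sumFrom a (n ℕ.∸ a) g   ≈⟨ +-cong
      (sumFrom-cong 0 a λ b _ b<a → reflexive (≡.cong (λ x → if x then f b else 0#) (<ᵇ-true b<a)))
      (sumFrom-zero a (n ℕ.∸ a) g λ b a≤b _ → reflexive (≡.cong (λ x → if x then f b else 0#) (<ᵇ-false a≤b))) ⟩
    sumFrom 0 a f + 0#                      ≈⟨ +-identityʳ _ ⟩
    sumFrom 0 a f                           ∎
    where
    g : ℕ → Carrier
    g b = if b <ᵇ a then f b else 0#

  sumFrom-above : ∀ {a n} f → a ℕ.≤ n → sumFrom 0 n (λ b → if not (b <ᵇ a) then f b else 0#) ≈ sumFrom a (n ℕ.∸ a) f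
  sumFrom-above {a} {n} f a≤n = begin
    sumFrom 0 n g                           ≈⟨ sumFrom-split g a≤n ⟩
    sumFrom 0 a g + sumFrom a (n ℕ.∸ a) g   ≈⟨ +-cong
      (sumFrom-zero 0 a g λ b _ b<a → reflexive (≡.cong (λ x → if not x then f b else 0#) (<ᵇ-true b<a)))
      (sumFrom-cong a (n ℕ.∸ a) λ b a≤b _ → reflexive (≡.cong (λ x → if not x then f b else 0#) (<ᵇ-false a≤b))) ⟩
    0# + sumFrom a (n ℕ.∸ a) f              ≈⟨ +-identityˡ _ ⟩
    sumFrom a (n ℕ.∸ a) f                   ∎
    where
    g : ℕ → Carrier
    g b = if not (b <ᵇ a) then f b else 0#

  weight : ℕ → List ℕ → Carrier
  weight j w = if desCheck k j w then q ^ inv w else 0#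

  -- `skip` preserves order, so the remainder keeps its inversions and descents. The first letter
  -- adds a inversions by `countLess-standard` and one descent test against b.
  weight-∷ : ∀ j {l a b w} → a ℕ.≤ suc l → Standard (suc l) (b ∷ w) →
    weight j (suc a ∷ map (skip (suc a)) (b ∷ w)) ≈
    (if (b <ᵇ suc a) xor not ⌊ k ∣? j ⌋ then q ^ a * weight (suc j) (b ∷ w) else 0#)
  weight-∷ j {l} {a} {b} {w} a≤ std = trans
    (reflexive (≡.cong₂ (λ p n → if p then q ^ n else 0#)
      (≡.cong₂ (λ x → (x xor not ⌊ k ∣? j ⌋) ∧_) (skip-<ᵇ-≤ {suc a} b ℕ.≤-refl) (desCheck-skip k (suc j) (suc a) (b ∷ w)))
      (≡.cong₂ ℕ._+_
        (≡.trans (countLess-map (suc a) (suc a) (skip (suc a)) (b ∷ w) (λ x → skip-<ᵇ-≤ {suc a} x ℕ.≤-refl)) (countLess-standard std a≤))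
        (inv-skip (suc a) (b ∷ w)))))
    (go ((b <ᵇ suc a) xor not ⌊ k ∣? j ⌋) (desCheck k (suc j) (b ∷ w)))
    where
    go : ∀ p p′ → (if p ∧ p′ then q ^ (a ℕ.+ inv (b ∷ w)) else 0#) ≈
                  (if p then q ^ a * (if p′ then q ^ inv (b ∷ w) else 0#) else 0#)
    go false p′    = refl
    go true  true  = ^-homo-* q a (inv (b ∷ w))
    go true  false = sym (zeroʳ _)

  sumPerm-weight : ∀ j l a → a ℕ.≤ l →
    sumPerm l (λ w → weight j (suc a ∷ map (skip (suc a)) w)) ≈ kWords j l a
  sumPerm-weight j zero    zero    ℕ.z≤n = refl
  sumPerm-weight j (suc l) a       a≤ = begin
    sumFrom 0 (suc l) (λ b → sumPerm l (λ w → weight j (suc a ∷ map (skip (suc a)) (suc b ∷ map (skip (suc b)) w))))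
      ≈⟨ sumFrom-cong 0 (suc l) step ⟩
    sumFrom 0 (suc l) (λ b → if (b <ᵇ a) xor not ⌊ k ∣? j ⌋ then q ^ a * kWords (suc j) l b else 0#)
      ≈⟨ restrict ⟩
    kWords j (suc l) a ∎
    where
    pull : ∀ p f → sumPerm l (λ w → if p then q ^ a * f w else 0#) ≈ (if p then q ^ a * sumPerm l f else 0#)
    pull true  f = sumPerm-scale l (q ^ a) f
    pull false f = sumPerm-zero l

    step : ∀ b → 0 ℕ.≤ b → b ℕ.< suc l →
      sumPerm l (λ w → weight j (suc a ∷ map (skip (suc a)) (suc b ∷ map (skip (suc b)) w))) ≈
      (if (b <ᵇ a) xor not ⌊ k ∣? j ⌋ then q ^ a * kWords (suc j) l b else 0#)
    step b _ (ℕ.s≤s b≤l) = begin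
      sumPerm l (λ w → weight j (suc a ∷ map (skip (suc a)) (suc b ∷ map (skip (suc b)) w)))
        ≈⟨ sumPerm-cong l (λ w std → weight-∷ j a≤ (b≤l ∷ std)) ⟩
      sumPerm l (λ w → if (b <ᵇ a) xor not ⌊ k ∣? j ⌋ then q ^ a * weight (suc j) (suc b ∷ map (skip (suc b)) w) else 0#)
        ≈⟨ pull ((b <ᵇ a) xor not ⌊ k ∣? j ⌋) _ ⟩
      (if (b <ᵇ a) xor not ⌊ k ∣? j ⌋ then q ^ a * sumPerm l (λ w → weight (suc j) (suc b ∷ map (skip (suc b)) w)) else 0#)
        ≈⟨ if-cong ((b <ᵇ a) xor not ⌊ k ∣? j ⌋) (*-congˡ (sumPerm-weight (suc j) l b b≤l)) ⟩
      (if (b <ᵇ a) xor not ⌊ k ∣? j ⌋ then q ^ a * kWords (suc j) l b else 0#) ∎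

    -- The test keeps b < a if k ∣ j and b ≥ a otherwise. Equality counts as an ascent, because a
    -- standardised letter b ≥ a stands for b + 1.
    restrict : sumFrom 0 (suc l) (λ b → if (b <ᵇ a) xor not ⌊ k ∣? j ⌋ then q ^ a * kWords (suc j) l b else 0#) ≈ kWords j (suc l) a
    restrict with k ∣? j
    ... | yes _ = trans (sumFrom-cong 0 (suc l) (λ b _ _ → reflexive (≡.cong (λ x → if x then q ^ a * kWords (suc j) l b else 0#) (xor-falseʳ (b <ᵇ a)))))
                        (trans (sumFrom-below _ a≤) (sumFrom-scale 0 a (q ^ a) _))
      where
      xor-falseʳ : ∀ b → b xor false ≡ b
      xor-falseʳ true  = ≡.refl
      xor-falseʳ false = ≡.refl
    ... | no  _ = trans (sumFrom-cong 0 (suc l) (λ b _ _ → reflexive (≡.cong (λ x → if x then q ^ a * kWords (suc j) l b else 0#) (xor-trueʳ (b <ᵇ a)))))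
                        (trans (sumFrom-above _ a≤) (sumFrom-scale a (suc l ℕ.∸ a) (q ^ a) _))
      where
      xor-trueʳ : ∀ b → b xor true ≡ not b
      xor-trueʳ true  = ≡.refl
      xor-trueʳ false = ≡.refl

  sum-permutations : ∀ l → sumList (permutations (suc l)) (λ w → if hasDesSet k w then q ^ inv w else 0#) ≈ euler (suc l)
  sum-permutations l = begin
    sumList (permutations (suc l)) (weight 1)
      ≈⟨ sumList-filter distinct (words (suc l) (suc l)) (weight 1) ⟩
    sumList (words (suc l) (suc l)) (λ w → if distinct w then weight 1 w else 0#)
      ≈⟨ sum-distinct (suc l) (weight 1) ⟩
    sumFrom 0 (suc l) (λ a → sumPerm l (λ w → weight 1 (suc a ∷ map (skip (suc a)) w)))
      ≈⟨ sumFrom-cong 0 (suc l) (λ a _ a< → sumPerm-weight 1 l a (ℕ.≤-pred a<)) ⟩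
    euler (suc l) ∎

-- The ideal generated by [k] at q^a and 1 - q^j.

module Divisibility {c ℓ p} (Q : QRing c ℓ) (B : SaturatedSubring (QRing.R Q) p) (q∈B : SaturatedSubring.Mem B (QRing.q Q))
  (k : ℕ) (k-prime : Prime k) where

  open QRing Q
  open SaturatedSubring B
  open Exp semiring using (^-homo-*; ^-assocʳ; ^-congʳ)
  open Mult semiring using (_×_; ×-congʳ; ×-comm-*; ×-assoc-*)
  open Solver commutativeSemiring using (solve; _:=_; _:+_; _:*_; con)
  open SetoidReasoning setoid
  open Decimation R k
  open QExponential Q
  open Boustrophedon Q k

  ^-closed : ∀ {x} → Mem x → ∀ n → Mem (x ^ n)
  ^-closed x∈ zero    = 1-closed
  ^-closed x∈ (suc n) = *-closed x∈ (^-closed x∈ n)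

  ×-closed : ∀ n {x} → Mem x → Mem (n × x)
  ×-closed zero    x∈ = 0-closed
  ×-closed (suc n) x∈ = +-closed x∈ (×-closed n x∈)

  bracket : ℕ → Carrier → Carrier
  bracket zero    x = 0#
  bracket (suc n) x = 1# + x * bracket n x

  bracket-closed : ∀ n {x} → Mem x → Mem (bracket n x)
  bracket-closed zero    x∈ = 0-closed
  bracket-closed (suc n) x∈ = +-closed 1-closed (*-closed x∈ (bracket-closed n x∈))

  -- The finite geometric sum, with 1 - x replaced by any d satisfying d + x = 1. The conclusion has
  -- the shape of the hypothesis, so the lemma can be applied to its own result, as `inBracket`
  -- does.
  bracket-telescope : ∀ n {d x} → d + x ≈ 1# → d * bracket n x + x ^ n ≈ 1#
  bracket-telescope zero    {d} d+x≈1 = trans (+-congʳ (zeroʳ d)) (+-identityˡ _)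
  bracket-telescope (suc n) {d} {x} d+x≈1 = begin
    d * (1# + x * bracket n x) + x * x ^ n   ≈⟨ solve 4 (λ d x b p → d :* (con 1 :+ x :* b) :+ x :* p := d :+ x :* (d :* b :+ p)) refl _ _ _ _ ⟩
    d + x * (d * bracket n x + x ^ n)        ≈⟨ +-congˡ (*-congˡ (bracket-telescope n d+x≈1)) ⟩
    d + x * 1#                               ≈⟨ +-congˡ (*-identityʳ _) ⟩
    d + x                                    ≈⟨ d+x≈1 ⟩
    1#                                       ∎

  -- Modulo d = 1 - x every power of x is 1, so a bracket of n terms reduces to n.
  bracket-at-1 : ∀ n {d x} → Mem x → d + x ≈ 1# → ∃ λ z → Mem z And n × 1# ≈ bracket n x + d * z
  bracket-at-1 zero    {d} x∈ d+x≈1 = 0# , 0-closed , sym (trans (+-identityˡ _) (zeroʳ d))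
  bracket-at-1 (suc n) {d} {x} x∈ d+x≈1 with bracket-at-1 n x∈ d+x≈1
  ... | z , z∈ , n≈ = z + bracket n x , +-closed z∈ (bracket-closed n x∈) , (begin
    1# + n × 1#                                    ≈⟨ +-congˡ n≈ ⟩
    1# + (bracket n x + d * z)                     ≈⟨ solve 2 (λ b e → con 1 :+ (b :+ e) := con 1 :+ (con 1 :* b :+ e)) refl _ _ ⟩
    1# + (1# * bracket n x + d * z)                ≈⟨ +-congˡ (+-congʳ (*-congʳ d+x≈1)) ⟨
    1# + ((d + x) * bracket n x + d * z)           ≈⟨ solve 4 (λ d x b z → con 1 :+ ((d :+ x) :* b :+ d :* z) := con 1 :+ x :* b :+ d :* (z :+ b)) refl _ _ _ _ ⟩
    1# + x * bracket n x + d * (z + bracket n x)   ∎)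

  minus+ : ∀ x → 1# - x + x ≈ 1#
  minus+ x = trans (+-assoc _ _ _) (trans (+-congˡ (-‿inverseˡ x)) (+-identityʳ _))

  minus-closed : ∀ {x} → Mem x → Mem (1# - x)
  minus-closed x∈ = +-closed 1-closed (neg-closed x∈)

  coprime-prime : ∀ {j} → ¬ k ∣ j → Coprime k j
  coprime-prime k∤j (d∣k , d∣j) with prime⇒irreducible k-prime d∣k
  ... | inj₁ d≡1    = d≡1
  ... | inj₂ ≡.refl = ⊥-elim (k∤j d∣j)

  -- 1 - X = (1 - XW) - X (1 - W)
  peel : ∀ {d X W a₁ a₂} → d + X ≈ 1# → a₁ + X * W ≈ 1# → a₂ + W ≈ 1# → d ≈ a₁ + - X * a₂
  peel {d} {X} {W} {a₁} {a₂} d+X a₁+XW a₂+W = ∙-cancelʳ (X * a₂ + X * W) _ _ (begin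
    d + (X * a₂ + X * W)                     ≈⟨ +-congˡ (trans (sym (distribˡ _ _ _)) (trans (*-congˡ a₂+W) (*-identityʳ _))) ⟩
    d + X                                    ≈⟨ trans d+X (sym a₁+XW) ⟩
    a₁ + X * W                               ≈⟨ +-congˡ (trans (+-congʳ (trans (*-congʳ (-‿inverseˡ X)) (zeroˡ a₂))) (+-identityˡ _)) ⟨
    a₁ + ((- X + X) * a₂ + X * W)            ≈⟨ solve 5 (λ a m x b w → a :+ ((m :+ x) :* b :+ x :* w) := a :+ m :* b :+ (x :* b :+ x :* w)) refl _ _ _ _ _ ⟩
    a₁ + - X * a₂ + (X * a₂ + X * W)         ∎)
    where open GroupProperties +-group using (∙-cancelʳ)

  -- A Bézout relation between k and j puts 1 - q^a, and with it k, into the ideal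
  -- generated by [k] at q^a and 1 - q^j.
  comaximal : ∀ a {j} → ¬ k ∣ j →
    ∃₂ λ u v → Mem u And Mem v And k × 1# ≈ bracket k (q ^ a) * u + (1# - q ^ j) * v
  comaximal a {j} k∤j = combine 1-X∈ideal (bracket-at-1 k X∈ (minus+ X))
    where
    X d y g : Carrier
    X = q ^ a
    d = 1# - X
    y = 1# - q ^ j
    g = bracket k X

    X∈ : Mem X
    X∈ = ^-closed q∈B a
    qʲ∈ : Mem (q ^ j)
    qʲ∈ = ^-closed q∈B j

    inBracket : ∀ m → d * g * bracket m (X ^ k) + q ^ (a ℕ.* k ℕ.* m) ≈ 1#
    inBracket m = begin
      d * g * bracket m (X ^ k) + q ^ (a ℕ.* k ℕ.* m)   ≈⟨ +-congˡ (trans (^-assocʳ X k m) (^-assocʳ′ m)) ⟨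
      d * g * bracket m (X ^ k) + (X ^ k) ^ m           ≈⟨ bracket-telescope m (bracket-telescope k (minus+ X)) ⟩
      1#                                                ∎
      where
      ^-assocʳ′ : ∀ m → X ^ (k ℕ.* m) ≈ q ^ (a ℕ.* k ℕ.* m)
      ^-assocʳ′ m = trans (^-assocʳ q a (k ℕ.* m)) (^-congʳ q (≡.sym (ℕ.*-assoc a k m)))

    inMinus : ∀ m → y * bracket m (q ^ j) + q ^ (j ℕ.* m) ≈ 1#
    inMinus m = trans (+-congˡ (sym (^-assocʳ q j m))) (bracket-telescope m (minus+ (q ^ j)))

    1-X∈ideal : ∃₂ λ u v → Mem u And Mem v And d ≈ g * u + y * v
    1-X∈ideal with coprime-Bézout (coprime-prime k∤j)
    -- Here 1 + t j = s k; multiplied by a it gives a k s = a + j a t, so `peel` applies with W =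
    -- q^(j a t). In the other case k and j exchange roles.
    ... | Bézout.+- s t eq =
      d * bracket s (X ^ k) , - X * bracket (a ℕ.* t) (q ^ j)
      , *-closed (minus-closed X∈) (bracket-closed s (^-closed X∈ k))
      , *-closed (neg-closed X∈) (bracket-closed (a ℕ.* t) qʲ∈)
      , (begin
      d
        ≈⟨ peel (minus+ X) (trans (+-congˡ (trans (sym (^-homo-* q a (j ℕ.* (a ℕ.* t)))) (^-congʳ q (≡.sym exponents)))) (inBracket s)) (inMinus (a ℕ.* t)) ⟩
      d * g * bracket s (X ^ k) + - X * (y * bracket (a ℕ.* t) (q ^ j))
        ≈⟨ solve 6 (λ d g b m y c → d :* g :* b :+ m :* (y :* c) := g :* (d :* b) :+ y :* (m :* c)) refl _ _ _ _ _ _ ⟩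
      g * (d * bracket s (X ^ k)) + y * (- X * bracket (a ℕ.* t) (q ^ j)) ∎)
      where
      exponents : a ℕ.* k ℕ.* s ≡ a ℕ.+ j ℕ.* (a ℕ.* t)
      exponents = ≡.trans (ℕS.solve 3 (λ a k s → a ℕS.:* k ℕS.:* s ℕS.:= a ℕS.:* (s ℕS.:* k)) ≡.refl a k s)
        (≡.trans (≡.cong (a ℕ.*_) (≡.sym eq))
          (ℕS.solve 3 (λ a t j → a ℕS.:* (ℕS.con 1 ℕS.:+ t ℕS.:* j) ℕS.:= a ℕS.:+ j ℕS.:* (a ℕS.:* t)) ≡.refl a t j))
    ... | Bézout.-+ s t eq =
      - X * (d * bracket s (X ^ k)) , bracket (a ℕ.* t) (q ^ j)
      , *-closed (neg-closed X∈) (*-closed (minus-closed X∈) (bracket-closed s (^-closed X∈ k)))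
      , bracket-closed (a ℕ.* t) qʲ∈
      , (begin
      d
        ≈⟨ peel (minus+ X) (trans (+-congˡ (trans (sym (^-homo-* q a (a ℕ.* k ℕ.* s))) (^-congʳ q (≡.sym exponents)))) (inMinus (a ℕ.* t))) (inBracket s) ⟩
      y * bracket (a ℕ.* t) (q ^ j) + - X * (d * g * bracket s (X ^ k))
        ≈⟨ solve 6 (λ d g b m y c → y :* c :+ m :* (d :* g :* b) := g :* (m :* (d :* b)) :+ y :* c) refl _ _ _ _ _ _ ⟩
      g * (- X * (d * bracket s (X ^ k))) + y * bracket (a ℕ.* t) (q ^ j) ∎)
      where
      exponents : j ℕ.* (a ℕ.* t) ≡ a ℕ.+ a ℕ.* k ℕ.* s
      exponents = ≡.trans (ℕS.solve 3 (λ a t j → j ℕS.:* (a ℕS.:* t) ℕS.:= a ℕS.:* (t ℕS.:* j)) ≡.refl a t j)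
        (≡.trans (≡.cong (a ℕ.*_) (≡.sym eq))
          (ℕS.solve 3 (λ a k s → a ℕS.:* (ℕS.con 1 ℕS.:+ s ℕS.:* k) ℕS.:= a ℕS.:+ a ℕS.:* k ℕS.:* s) ≡.refl a k s))

    -- k is congruent to g modulo 1 - X, and 1 - X already lies in the ideal.
    combine : (∃₂ λ u v → Mem u And Mem v And d ≈ g * u + y * v) → (∃ λ z → Mem z And k × 1# ≈ g + d * z) →
      ∃₂ λ u v → Mem u And Mem v And k × 1# ≈ g * u + y * v
    combine (u , v , u∈ , v∈ , d≈) (z , z∈ , k≈) =
      1# + u * z , v * z , +-closed 1-closed (*-closed u∈ z∈) , *-closed v∈ z∈ , (begin
        k × 1#                            ≈⟨ k≈ ⟩
        g + d * z                         ≈⟨ +-congˡ (*-congʳ d≈) ⟩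
        g + (g * u + y * v) * z           ≈⟨ solve 5 (λ g u y v z → g :+ (g :* u :+ y :* v) :* z := g :* (con 1 :+ u :* z) :+ y :* (v :* z)) refl _ _ _ _ _ ⟩
        g * (1# + u * z) + y * (v * z)    ∎)

  -- Denominators that can be cancelled against the brackets.

  bracketProduct : ℕ → Carrier
  bracketProduct zero    = 1#
  bracketProduct (suc n) = bracketProduct n * bracket k (q ^ suc n)

  -- Coprimality to all `bracketProduct n`, stated as the cancellation it is meant to provide. With
  -- x ranging over the ambient ring, the property passes to products without any unique
  -- factorisation.
  record Denominator (s : Carrier) : Set (c ⊔ p) where
    field
      member : Mem s
      cancel : ∀ n {x} → Mem (bracketProduct n * x) → Mem (s * x) → Mem x
  open Denominator

  ÷k-closed : ∀ {x} → Mem (k × x) → Mem x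
  ÷k-closed = divide k (prime⇒nonZero k-prime)
    where
    divide : ∀ n {x} → ℕ.NonZero n → Mem (n × x) → Mem x
    divide (suc n) _ = ÷-closed n

  1-denominator : Denominator 1#
  1-denominator .member = 1-closed
  1-denominator .cancel n _ = resp (*-identityˡ _)

  *-denominator : ∀ {s t} → Denominator s → Denominator t → Denominator (s * t)
  *-denominator         S T .member = *-closed (S .member) (T .member)
  *-denominator {s} {t} S T .cancel n {x} Px∈ stx∈ = T .cancel n Px∈
    (S .cancel n (resp (solve 3 (λ t P x → t :* (P :* x) := P :* (t :* x)) refl t (bracketProduct n) x) (*-closed (T .member) Px∈))
                 (resp (*-assoc _ _ _) stx∈))

  ×-denominator : ∀ n {s} → Denominator s → Denominator (suc n × s)
  ×-denominator n S .member = ×-closed (suc n) (S .member)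
  ×-denominator n {s} S .cancel m {x} Px∈ nsx∈ = S .cancel m Px∈ (÷-closed n (resp (×-assoc-* (suc n) s x) nsx∈))

  -- Induction on n: applied to g x, with g the last bracket, the hypothesis for n makes g x a
  -- member. Since y x is one as well, `comaximal` puts k x, and hence x, into the subring.
  minus-denominator : ∀ {j} → ¬ k ∣ j → Denominator (1# - q ^ j)
  minus-denominator {j} k∤j .member = minus-closed (^-closed q∈B j)
  minus-denominator {j} k∤j .cancel = go
    where
    y = 1# - q ^ j
    go : ∀ n {x} → Mem (bracketProduct n * x) → Mem (y * x) → Mem x
    go zero            Px∈ yx∈ = resp (*-identityˡ _) Px∈
    go (suc n) {x} Px∈ yx∈ = from-ideal (comaximal (suc n) k∤j)
      where
      g = bracket k (q ^ suc n)
      gx∈ : Mem (g * x)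
      gx∈ = go n (resp (*-assoc (bracketProduct n) g x) Px∈)
        (resp (solve 3 (λ g y x → g :* (y :* x) := y :* (g :* x)) refl g y x)
          (*-closed (bracket-closed k (^-closed q∈B (suc n))) yx∈))
      from-ideal : (∃₂ λ u v → Mem u And Mem v And k × 1# ≈ g * u + y * v) → Mem x
      from-ideal (u , v , u∈ , v∈ , k≈) = ÷k-closed (resp (begin
        u * (g * x) + v * (y * x)   ≈⟨ solve 5 (λ u g x v y → u :* (g :* x) :+ v :* (y :* x) := (g :* u :+ y :* v) :* x) refl u g x v y ⟩
        (g * u + y * v) * x         ≈⟨ *-congʳ k≈ ⟨
        (k × 1#) * x                ≈⟨ ×-assoc-* k 1# x ⟩
        k × (1# * x)                ≈⟨ ×-congʳ k (*-identityˡ x) ⟩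
        k × x                       ∎) (+-closed (*-closed u∈ gx∈) (*-closed v∈ yx∈)))

  open RingProperties ring using (-‿distribʳ-*)

  -- Sums and products take the product of the denominators. Saturation holds because positive
  -- integers may be absorbed into the denominator.
  fractions : SaturatedSubring R (c ⊔ p)
  fractions = record
    { Mem        = λ x → ∃ λ s → Denominator s And Mem (s * x)
    ; resp       = λ { x≈y (s , S , sx∈) → s , S , resp (*-congˡ x≈y) sx∈ }
    ; 1-closed   = 1# , 1-denominator , *-closed 1-closed 1-closed
    ; +-closed   = λ { {x} {y} (s , S , sx∈) (t , T , ty∈) → s * t , *-denominator S T ,
                       resp (solve 4 (λ s t x y → t :* (s :* x) :+ s :* (t :* y) := s :* t :* (x :+ y)) refl s t x y)
                         (+-closed (*-closed (T .member) sx∈) (*-closed (S .member) ty∈)) }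
    ; neg-closed = λ { (s , S , sx∈) → s , S , resp (-‿distribʳ-* _ _) (neg-closed sx∈) }
    ; *-closed   = λ { {x} {y} (s , S , sx∈) (t , T , ty∈) → s * t , *-denominator S T ,
                       resp (solve 4 (λ s t x y → s :* x :* (t :* y) := s :* t :* (x :* y)) refl s t x y) (*-closed sx∈ ty∈) }
    ; ÷-closed   = λ { n {x} (s , S , sx∈) → suc n × s , ×-denominator n S ,
                       resp (trans (×-comm-* (suc n) s x) (sym (×-assoc-* (suc n) s x))) sx∈ }
    }

  minus-geo : ∀ n → (1# - q ^ suc n) * geo n ≈ 1#
  minus-geo n = ∙-cancelʳ (q ^ suc n * geo n) _ _ (begin
    (1# - q ^ suc n) * geo n + q ^ suc n * geo n   ≈⟨ distribʳ _ _ _ ⟨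
    (1# - q ^ suc n + q ^ suc n) * geo n           ≈⟨ *-congʳ (minus+ _) ⟩
    1# * geo n                                     ≈⟨ *-identityˡ _ ⟩
    geo n                                          ≈⟨ geo-unfold n ⟩
    1# + q ^ suc n * geo n                         ∎)
    where open GroupProperties +-group using (∙-cancelʳ)

  ratio-fraction : ∀ n → SaturatedSubring.Mem fractions (ratio n)
  ratio-fraction = riccati-closed fractions qlog ratio refl
    (F.resp (reflexive (≡.sym ratio-zero)) F.1-closed) others-qlog
    (riccati qexp qlog ratio refl D-qexp ratio⊛multiples)
    where
    module F = SaturatedSubring fractions
    others-qlog : ∀ n → F.Mem (others qlog n)
    others-qlog n with k ∣? n
    others-qlog n       | yes _  = F.0-closed
    others-qlog zero    | no k∤0 = ⊥-elim (k∤0 (k ∣0))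
    others-qlog (suc n) | no k∤n = 1# - q ^ suc n , minus-denominator k∤n , resp (sym (minus-geo n)) 1-closed

  -- Divisibility of (q)_N and of the q-Euler numbers.

  qpoch : ℕ → Carrier
  qpoch zero    = 1#
  qpoch (suc n) = qpoch n * (1# - q ^ suc n)

  qpoch-qexp : ∀ n → qpoch n * qexp n ≈ 1#
  qpoch-qexp zero    = *-identityˡ _
  qpoch-qexp (suc n) = begin
    qpoch n * (1# - q ^ suc n) * (qexp n * geo n)     ≈⟨ solve 4 (λ a b c d → a :* b :* (c :* d) := a :* c :* (b :* d)) refl (qpoch n) (1# - q ^ suc n) (qexp n) (geo n) ⟩
    qpoch n * qexp n * ((1# - q ^ suc n) * geo n)     ≈⟨ *-cong (qpoch-qexp n) (minus-geo n) ⟩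
    1# * 1#                                           ≈⟨ *-identityˡ _ ⟩
    1#                                                ∎

  bracketProduct∣qpoch : ∀ n i → ∃ λ w → Mem w And qpoch (i ℕ.+ n ℕ.* k) ≈ bracketProduct n * w
  bracketProduct∣qpoch n (suc i) with bracketProduct∣qpoch n i
  ... | w , w∈ , eq = w * (1# - q ^ suc (i ℕ.+ n ℕ.* k)) , *-closed w∈ (minus-closed (^-closed q∈B (suc (i ℕ.+ n ℕ.* k))))
                    , trans (*-congʳ eq) (*-assoc _ _ _)
  bracketProduct∣qpoch zero    zero = 1# , 1-closed , sym (*-identityˡ _)
  -- The top factor 1 - q^((n+1)k) supplies [k] at q^(n+1); the k - 1 factors below it go into the
  -- cofactor. `block` writes k as `suc m` to expose the top factor.
  bracketProduct∣qpoch (suc n) zero = block k (prime⇒nonZero k-prime) ≡.refl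
    where
    d = 1# - q ^ suc n
    factor : 1# - q ^ (k ℕ.+ n ℕ.* k) ≈ d * bracket k (q ^ suc n)
    factor = ∙-cancelʳ (q ^ (k ℕ.+ n ℕ.* k)) _ _ (begin
      1# - q ^ (k ℕ.+ n ℕ.* k) + q ^ (k ℕ.+ n ℕ.* k)           ≈⟨ minus+ _ ⟩
      1#                                                       ≈⟨ bracket-telescope k (minus+ (q ^ suc n)) ⟨
      d * bracket k (q ^ suc n) + (q ^ suc n) ^ k              ≈⟨ +-congˡ (^-assocʳ q (suc n) k) ⟩
      d * bracket k (q ^ suc n) + q ^ (k ℕ.+ n ℕ.* k)          ∎)
      where open GroupProperties +-group using (∙-cancelʳ)

    block : ∀ m → ℕ.NonZero m → m ≡ k → ∃ λ w → Mem w And qpoch (k ℕ.+ n ℕ.* k) ≈ bracketProduct (suc n) * w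
    block (suc m) _ m≡k with bracketProduct∣qpoch n m
    ... | w , w∈ , eq = w * d , *-closed w∈ (minus-closed (^-closed q∈B (suc n))) , (begin
      qpoch (k ℕ.+ n ℕ.* k)                                              ≡⟨ ≡.cong (λ x → qpoch (x ℕ.+ n ℕ.* k)) m≡k ⟨
      qpoch (m ℕ.+ n ℕ.* k) * (1# - q ^ (suc m ℕ.+ n ℕ.* k))             ≈⟨ *-cong eq (reflexive (≡.cong (λ x → 1# - q ^ (x ℕ.+ n ℕ.* k)) m≡k)) ⟩
      bracketProduct n * w * (1# - q ^ (k ℕ.+ n ℕ.* k))                  ≈⟨ *-congˡ factor ⟩
      bracketProduct n * w * (d * bracket k (q ^ suc n))                 ≈⟨ solve 4 (λ P w d g → P :* w :* (d :* g) := P :* g :* (w :* d)) refl (bracketProduct n) w d (bracket k (q ^ suc n)) ⟩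
      bracketProduct (suc n) * (w * d)                                   ∎)

  sign-closed : ∀ n → Mem (sign n)
  sign-closed zero    = 1-closed
  sign-closed (suc n) with k ∣? suc n
  ... | yes _ = neg-closed (sign-closed n)
  ... | no  _ = sign-closed n

  bracketProduct∣euler : ∀ n {i} → 1 ℕ.≤ i → i ℕ.< k → Mem (euler (i ℕ.+ n ℕ.* k)) →
    ∃ λ x → Mem x And euler (i ℕ.+ n ℕ.* k) ≈ bracketProduct n * x
  bracketProduct∣euler n {i} 1≤i i<k E∈ = quotient (bracketProduct∣qpoch n i) (ratio-fraction N)
    where
    N = i ℕ.+ n ℕ.* k

    k∤N : ¬ k ∣ N
    k∤N k∣N = >⇒∤ {{ℕ.>-nonZero 1≤i}} i<k (∣m+n∣m⇒∣n (≡.subst (k ∣_) (ℕ.+-comm i (n ℕ.* k)) k∣N) (n∣m*n n))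

    quotient : (∃ λ w → Mem w And qpoch N ≈ bracketProduct n * w) → SaturatedSubring.Mem fractions (ratio N) →
      ∃ λ x → Mem x And euler N ≈ bracketProduct n * x
    quotient (w , w∈ , qpoch≈) (s , S , sρ∈) = x , S .cancel n (resp E≈Px E∈) sx∈ , E≈Px
      where
      -- As `sign N` squares to 1 and `qpoch N` is inverse to `qexp N`, the Euler number is sign ·
      -- (q)_N · ratio; x is what remains after taking `bracketProduct n` out of (q)_N.
      x = sign N * (w * ratio N)

      E≈Px : euler N ≈ bracketProduct n * x
      E≈Px = begin
        euler N                                                       ≈⟨ *-identityˡ _ ⟨
        1# * euler N                                                  ≈⟨ *-congʳ (*-identityˡ _) ⟨
        1# * 1# * euler N                                             ≈⟨ *-congʳ (*-cong (sign² N) (qpoch-qexp N)) ⟨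
        sign N * sign N * (qpoch N * qexp N) * euler N                ≈⟨ *-congʳ (*-congˡ (*-congʳ qpoch≈)) ⟩
        sign N * sign N * (bracketProduct n * w * qexp N) * euler N
          ≈⟨ solve 5 (λ s P w e E → s :* s :* (P :* w :* e) :* E := P :* (s :* (w :* (s :* (E :* e))))) refl
               (sign N) (bracketProduct n) w (qexp N) (euler N) ⟩
        bracketProduct n * (sign N * (w * (sign N * (euler N * qexp N))))
          ≈⟨ *-congˡ (*-congˡ (*-congˡ (reflexive (ratio-no k∤N)))) ⟨
        bracketProduct n * x                                          ∎

      sx∈ : Mem (s * x)
      sx∈ = resp (solve 4 (λ σ w s r → σ :* w :* (s :* r) := s :* (σ :* (w :* r))) refl (sign N) w s (ratio N))
        (*-closed (*-closed (sign-closed N) w∈) sρ∈)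

-- The ring ℤ[[q]] and its saturated subring ℤ[q].

open import Data.Integer using (+_)
open import Data.Nat using (_+_; _*_; _≤_; _<_)
open PowerSeries ℤ.+-*-commutativeRing
module A = CommutativeRing seriesRing
open Exp A.semiring using (_^_; ^-homo-*; ^-congʳ)
open Mult A.semiring using (_×_)

var^-⊛-< : ∀ m f {n} → n < m → (var ^ m ⊛ f) n ≡ + 0
var^-⊛-< (suc m) f {zero}  _          = A.*-assoc var (var ^ m) f 0
var^-⊛-< (suc m) f {suc n} (s≤s n<m) =
  ≡.trans (A.*-assoc var (var ^ m) f (suc n)) (≡.trans (var-⊛-suc (var ^ m ⊛ f) n) (var^-⊛-< m f n<m))

var^-⊛-+ : ∀ m f n → (var ^ m ⊛ f) (m + n) ≡ f n
var^-⊛-+ zero    f n = A.*-identityˡ f n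
var^-⊛-+ (suc m) f n =
  ≡.trans (A.*-assoc var (var ^ m) f (suc (m + n))) (≡.trans (var-⊛-suc (var ^ m ⊛ f) (m + n)) (var^-⊛-+ m f n))

geometric : ℕ → Series
geometric n j = if ⌊ suc n ∣? j ⌋ then + 1 else + 0

geometric-unfold : ∀ n → geometric n ≋ constant (+ 1) ⊕ var ^ suc n ⊛ geometric n
geometric-unfold n j with ℕ.<-≤-connex j (suc n)
geometric-unfold n zero    | inj₁ j<n with suc n ∣? 0
... | yes _  = ≡.cong (λ x → + 1 ℤ.+ x) (≡.sym (var^-⊛-< (suc n) (geometric n) j<n))
... | no  ∤0 = ⊥-elim (∤0 (suc n ∣0))
geometric-unfold n (suc j) | inj₁ j<n with suc n ∣? suc j
... | yes ∣j = ⊥-elim (>⇒∤ j<n ∣j)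
... | no  _  = ≡.cong (λ x → + 0 ℤ.+ x) (≡.sym (var^-⊛-< (suc n) (geometric n) j<n))
geometric-unfold n j       | inj₂ n≤j = ≡.subst
  (λ j → geometric n j ≡ (constant (+ 1) ⊕ var ^ suc n ⊛ geometric n) j) (ℕ.m+[n∸m]≡n n≤j) (shifted (j Data.Nat.∸ suc n))
  where
  periodic : ∀ j → geometric n (suc n + j) ≡ geometric n j
  periodic j with suc n ∣? suc n + j | suc n ∣? j
  ... | yes _  | yes _  = ≡.refl
  ... | no  _  | no  _  = ≡.refl
  ... | yes p  | no  ¬p = ⊥-elim (¬p (∣m+n∣m⇒∣n p ∣-refl))
  ... | no  ¬p | yes p  = ⊥-elim (¬p (∣m∣n⇒∣m+n ∣-refl p))

  shifted : ∀ j → geometric n (suc n + j) ≡ + 0 ℤ.+ (var ^ suc n ⊛ geometric n) (suc n + j)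
  shifted j = ≡.trans (periodic j)
    (≡.trans (≡.sym (var^-⊛-+ (suc n) (geometric n) j)) (≡.sym (ℤ.+-identityˡ _)))

integerSeries : QRing 0ℓ 0ℓ
integerSeries = record { R = seriesRing ; q = var ; geo = geometric ; geo-unfold = geometric-unfold }

IsPolynomial : Series → Set
IsPolynomial f = ∃ λ d → ∀ n → d ≤ n → f n ≡ + 0

⊛-polynomial : ∀ d d′ f g → (∀ n → d ≤ n → f n ≡ + 0) → (∀ n → d′ ≤ n → g n ≡ + 0) →
  ∀ n → d + d′ ≤ n → (f ⊛ g) n ≡ + 0
⊛-polynomial zero    d′ f g f≡0 g≡0 n       _          = ⊛-zeroˡ g (λ m → f≡0 m z≤n) n
⊛-polynomial (suc d) d′ f g f≡0 g≡0 (suc n) (s≤s d≤n) = ≡.cong₂ ℤ._+_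
  (≡.trans (≡.cong (f 0 ℤ.*_) (g≡0 (suc n) (ℕ.m≤n⇒m≤1+n (ℕ.≤-trans (ℕ.m≤n+m d′ d) d≤n)))) (ℤ.*-zeroʳ (f 0)))
  (⊛-polynomial d d′ (tail f) g (λ m d≤m → f≡0 (suc m) (s≤s d≤m)) g≡0 n d≤n)

×-coefficient : ∀ m f n → (m × f) n ≡ + m ℤ.* f n
×-coefficient zero    f n = ≡.refl
×-coefficient (suc m) f n = ≡.trans (≡.cong (λ x → f n ℤ.+ x) (×-coefficient m f n)) (≡.sym (ℤ.suc-* (+ m) (f n)))

polynomials : SaturatedSubring seriesRing 0ℓ
polynomials = record
  { Mem        = IsPolynomial
  ; resp       = λ { f≋g (d , f≡0) → d , λ n d≤n → ≡.trans (≡.sym (f≋g n)) (f≡0 n d≤n) }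
  ; 1-closed   = 1 , λ { (suc n) _ → ≡.refl }
  ; +-closed   = λ { (d , f≡0) (d′ , g≡0) → d + d′ , λ n d≤n → ≡.cong₂ ℤ._+_
                     (f≡0 n (ℕ.≤-trans (ℕ.m≤m+n d d′) d≤n)) (g≡0 n (ℕ.≤-trans (ℕ.m≤n+m d′ d) d≤n)) }
  ; neg-closed = λ { (d , f≡0) → d , λ n d≤n → ≡.cong ℤ.-_ (f≡0 n d≤n) }
  ; *-closed   = λ { {f} {g} (d , f≡0) (d′ , g≡0) → d + d′ , ⊛-polynomial d d′ f g f≡0 g≡0 }
  ; ÷-closed   = λ { m {f} (d , mf≡0) → d , λ n d≤n → cancel m (f n) (≡.trans (≡.sym (×-coefficient (suc m) f n)) (mf≡0 n d≤n)) }
  }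
  where
  cancel : ∀ m x → + suc m ℤ.* x ≡ + 0 → x ≡ + 0
  cancel m x eq with ℤ.i*j≡0⇒i≡0∨j≡0 (+ suc m) eq
  ... | inj₂ x≡0 = x≡0

var-polynomial : IsPolynomial var
var-polynomial = 2 , λ { (suc (suc n)) _ → ≡.refl ; (suc zero) (s≤s ()) }

-- Coefficient lists as power series, and the conclusion.

coeff-+ₚ : ∀ P Q → coeff (P +ₚ Q) ≋ coeff P ⊕ coeff Q
coeff-+ₚ []      Q       n       = ≡.sym (ℤ.+-identityˡ _)
coeff-+ₚ (a ∷ P) []      n       = ≡.sym (ℤ.+-identityʳ _)
coeff-+ₚ (a ∷ P) (b ∷ Q) zero    = ≡.refl
coeff-+ₚ (a ∷ P) (b ∷ Q) (suc n) = coeff-+ₚ P Q n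

coeff-·ₚ : ∀ a P n → coeff (a ·ₚ P) n ≡ a ℤ.* coeff P n
coeff-·ₚ a []      n       = ≡.sym (ℤ.*-zeroʳ a)
coeff-·ₚ a (b ∷ P) zero    = ≡.refl
coeff-·ₚ a (b ∷ P) (suc n) = coeff-·ₚ a P n

coeff-*ₚ : ∀ P Q → coeff (P *ₚ Q) ≋ coeff P ⊛ coeff Q
coeff-*ₚ []      Q n       = ≡.sym (⊛-zeroˡ {coeff []} (coeff Q) (λ _ → ≡.refl) n)
coeff-*ₚ (a ∷ P) Q zero    = ≡.trans (coeff-+ₚ (a ·ₚ Q) (+ 0 ∷ P *ₚ Q) 0)
  (≡.trans (ℤ.+-identityʳ _) (coeff-·ₚ a Q 0))
coeff-*ₚ (a ∷ P) Q (suc n) = ≡.trans (coeff-+ₚ (a ·ₚ Q) (+ 0 ∷ P *ₚ Q) (suc n))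
  (≡.cong₂ ℤ._+_ (coeff-·ₚ a Q (suc n)) (coeff-*ₚ P Q n))

coeff-mono : ∀ m → coeff (mono m) ≋ var ^ m
coeff-mono zero    zero    = ≡.refl
coeff-mono zero    (suc n) = ≡.refl
coeff-mono (suc m) zero    = ≡.refl
coeff-mono (suc m) (suc n) = ≡.trans (coeff-mono m n) (≡.sym (var-⊛-suc (var ^ m) n))

coeff-polynomial : ∀ P → IsPolynomial (coeff P)
coeff-polynomial P = length P , vanish P
  where
  vanish : ∀ P n → length P ≤ n → coeff P n ≡ + 0
  vanish []      n       _          = ≡.refl
  vanish (a ∷ P) (suc n) (s≤s P≤n) = vanish P n P≤n

polynomial⇒Poly : ∀ {f} → IsPolynomial f → ∃ λ P → coeff P ≋ f
polynomial⇒Poly {f} (d , f≡0) = applyUpTo f d , coefficients d f f≡0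
  where
  coefficients : ∀ d f → (∀ n → d ≤ n → f n ≡ + 0) → coeff (applyUpTo f d) ≋ f
  coefficients zero    f f≡0 n       = ≡.sym (f≡0 n z≤n)
  coefficients (suc d) f f≡0 zero    = ≡.refl
  coefficients (suc d) f f≡0 (suc n) = coefficients d (tail f) (λ m d≤m → f≡0 (suc m) (s≤s d≤m)) n

module _ (k : ℕ) (k-prime : Prime k) where
  open Divisibility integerSeries polynomials var-polynomial k k-prime
  open Boustrophedon integerSeries k using (euler)
  open Words integerSeries k using (sumList; sum-permutations)

  coeff-qInt : ∀ a → coeff (qInt k a) ≋ bracket k (var ^ a)
  coeff-qInt a = A.trans (go k id 0 (λ _ → ≡.refl)) (A.*-identityˡ (bracket k (var ^ a)))
    where
    open SetoidReasoning A.setoid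
    -- `upTo` unfolds through `applyUpTo` with a shifting function, so the claim is generalised to
    -- brackets starting at exponent s a.
    go : ∀ n g s → (∀ i → g i ≡ s + i) →
      coeff (foldr (λ t acc → mono (t * a) +ₚ acc) [] (applyUpTo g n)) ≋ var ^ (s * a) ⊛ bracket n (var ^ a)
    go zero    g s eq = A.sym (A.zeroʳ (var ^ (s * a)))
    go (suc n) g s eq = begin
      coeff (mono (g 0 * a) +ₚ rest)
        ≈⟨ coeff-+ₚ (mono (g 0 * a)) rest ⟩
      coeff (mono (g 0 * a)) ⊕ coeff rest
        ≈⟨ A.+-cong (coeff-mono (g 0 * a)) (go n (g ∘ suc) (suc s) (λ i → ≡.trans (eq (suc i)) (ℕ.+-suc s i))) ⟩
      var ^ (g 0 * a) ⊕ var ^ (a + s * a) ⊛ b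
        ≈⟨ A.+-cong (^-congʳ var (≡.cong (_* a) (≡.trans (eq 0) (ℕ.+-identityʳ s))))
             (A.*-congʳ {b} (A.trans (^-homo-* var a (s * a)) (A.*-comm (var ^ a) x))) ⟩
      x ⊕ x ⊛ var ^ a ⊛ b
        ≈⟨ A.+-cong (A.sym (A.*-identityʳ x)) (A.*-assoc x (var ^ a) b) ⟩
      x ⊛ A.1# ⊕ x ⊛ (var ^ a ⊛ b)
        ≈⟨ A.distribˡ x A.1# (var ^ a ⊛ b) ⟨
      x ⊛ bracket (suc n) (var ^ a) ∎
      where
      rest = foldr (λ t acc → mono (t * a) +ₚ acc) [] (applyUpTo (g ∘ suc) n)
      b = bracket n (var ^ a)
      x = var ^ (s * a)

  coeff-qIntProd : ∀ n → coeff (qIntProd k n) ≋ bracketProduct n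
  coeff-qIntProd zero    = λ { zero → ≡.refl ; (suc n) → ≡.refl }
  coeff-qIntProd (suc n) = A.trans (coeff-*ₚ (qIntProd k n) (qInt k (suc n))) (⊛-cong (coeff-qIntProd n) (coeff-qInt (suc n)))

  coeff-qEuler : ∀ l → coeff (qEuler (suc l) k) ≋ euler (suc l)
  coeff-qEuler l = A.trans (go (permutations (suc l))) (sum-permutations l)
    where
    go : ∀ ws → coeff (foldr (λ w acc → (if hasDesSet k w then mono (inv w) else []) +ₚ acc) [] ws)
              ≋ sumList ws (λ w → if hasDesSet k w then var ^ inv w else A.0#)
    go []       n = ≡.refl
    go (w ∷ ws) n = ≡.trans (coeff-+ₚ (if hasDesSet k w then mono (inv w) else []) _ n) (≡.cong₂ ℤ._+_ head (go ws n))
      where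
      head : coeff (if hasDesSet k w then mono (inv w) else []) n ≡ (if hasDesSet k w then var ^ inv w else A.0#) n
      head with hasDesSet k w
      ... | true  = coeff-mono (inv w) n
      ... | false = ≡.refl

theorem3p2 : (k i : ℕ) → Prime k → 1 ≤ i → i < k →
    (n : ℕ) → qIntProd k n ∣ₚ qEuler (n * k + i) k
-- As i is positive, the index is a successor, the form in which `coeff-qEuler` applies.
theorem3p2 k (suc i) k-prime 1≤i i<k n rewrite ℕ.+-comm (n * k) (suc i) =
  quotient (bracketProduct∣euler n 1≤i i<k (resp (coeff-qEuler k k-prime l) (coeff-polynomial (qEuler (suc l) k))))
  where
  open Divisibility integerSeries polynomials var-polynomial k k-prime
  open Boustrophedon integerSeries k using (euler)
  open SaturatedSubring polynomials using (resp)
  open SetoidReasoning A.setoid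
  l = i + n * k
  quotient : (∃ λ x → IsPolynomial x And euler (suc l) ≋ bracketProduct n ⊛ x) → qIntProd k n ∣ₚ qEuler (suc l) k
  quotient (x , x-poly , E≋Px) with polynomial⇒Poly x-poly
  ... | X , X≋x = X , (begin
    coeff (qEuler (suc l) k)         ≈⟨ coeff-qEuler k k-prime l ⟩
    euler (suc l)                    ≈⟨ E≋Px ⟩
    bracketProduct n ⊛ x             ≈⟨ ⊛-cong (A.sym (coeff-qIntProd k k-prime n)) (A.sym X≋x) ⟩
    coeff (qIntProd k n) ⊛ coeff X   ≈⟨ coeff-*ₚ (qIntProd k n) X ⟨
    coeff (qIntProd k n *ₚ X)        ∎)
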